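{- One has $153\le f(3,6)\le255$.
   Context: $f(w,k)$ denotes the maximum size of a finite family of distinct $w$-element sets (on an arbitrary finite ground set) containing no $k$-sunflower. A $k$-sunflower is a collection of $k$ distinct sets $A_1,\dots,A_k$ for which there is a set $C$ (the core, possibly empty) with $A_i\cap A_j=C$ for all $i\ne j$. -}

module Defs where

open import Data.Nat using (ℕ; _≤_)
open import Data.Fin using (Fin)
open import Data.Fin.Subset using (Subset; _∩_; ∣_∣)
open import Data.List using (List; length)
open import Data.List.Membership.Propositional using (_∈_)
open import Data.List.Relation.Unary.All using (All)
open import Data.List.Relation.Unary.Unique.Propositional using (Unique)
open import Data.Product using (_×_; ∃-syntax)
open import Function.Definitions using (Injective)
open import Relation.Binary.PropositionalEquality using (_≡_; _≢_)
open import Relation.Nullary using (¬_)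

-- Finite ground sets are represented by Fin n with n arbitrary.

IsSunflower : ∀ {n k} → (Fin k → Subset n) → Set
IsSunflower A =
  Injective _≡_ _≡_ A ×
  ∃[ C ] (∀ i j → i ≢ j → A i ∩ A j ≡ C)

ContainsSunflower : ∀ {n} → ℕ → List (Subset n) → Set
ContainsSunflower {n} k F =
  ∃[ A ] IsSunflower {n} {k} A × (∀ i → A i ∈ F)

-- A family of distinct sets is a duplicate-free list, so that its size is
-- the length of the list.
record SunflowerFree (w k : ℕ) {n : ℕ} (F : List (Subset n)) : Set where
  field
    distinct    : Unique F
    uniform     : All (λ A → ∣ A ∣ ≡ w) F
    noSunflower : ¬ ContainsSunflower k F

-- The graph of f: IsMaxSize w k m says that f(w,k) exists and equals m.
-- The ground set is not fixed: n varies in both fields.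
record IsMaxSize (w k m : ℕ) : Set where
  field
    attained   : ∃[ n ] ∃[ F ] SunflowerFree w k {n} F × length F ≡ m
    upperBound : ∀ {n} (F : List (Subset n)) → SunflowerFree w k F → length F ≤ m

{-# OPTIONS --safe #-}
-- Upper bound.  In a family F of triples without a 6-sunflower, the link of a
-- point is a graph with maximum degree and matching number at most 5, hence
-- with at most 27 edges (Abbott-Hanson-Sauer; at most 22 if the matching number
-- is 4).  Let M be a maximum matching of F, W its set of points, and call an edge
-- private to v ∈ W if it meets W in v only.  Each A ∈ M carries at most 22
-- private edges: those at a fixed v ∈ A extend by A \ v to a matching in the link
-- of v, and those at different points of A meet pairwise, as otherwise two of them
-- would replace A.  Every edge meets W twice, or once and privately, and the edges
-- of M meet it three times, so 2|F| + |M| ≤ |M| (3 · 27 + 22), i.e. |F| ≤ 51 |M| ≤ 255.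
--
-- The graph bound is by induction on the matching number.  Either some vertex lies
-- in every maximum matching and is deleted, or by Gallai's lemma "no maximum
-- matching misses both u and v" is an equivalence relation, and the class of u has
-- at most 2m + 1 vertices, where m is its number of matching edges, and no
-- edges to the rest.
--
-- Lower bound.  Developing nine base blocks modulo 14, with no pair at distance 5,
-- gives 126 triples in which each link lives on 11 points; 27 more come from joining
-- a new point to a graph on 11 new vertices with 27 edges and maximum degree 5.
--
-- The maximum exists constructively because a family of m triples lives on 3m
-- points, so that attaining the size m is decidable.

module Submission where

open import Data.Bool using (_∨_)
import Data.Bool.Properties as Bool
open import Data.Empty using (⊥; ⊥-elim)
open import Data.Fin using (Fin; zero; suc; toℕ; #_) renaming (_≟_ to _≟ᶠ_)
open import Data.Fin.Properties using (suc-injective)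
open import Data.Fin.Subset using (Subset; _∩_; ∣_∣; inside; outside; _⊆_) renaming (_∈_ to _∈ˢ_; _∉_ to _∉ˢ_)
open import Data.Fin.Subset.Properties using (anySubset?; nonempty?; _⊆?_; ⊆-antisym; p∩q⊆p; x∈p∩q⁺; x∈p∩q⁻; ∩-comm) renaming (_∈?_ to _∈ˢ?_)
open import Data.List using (List; []; _∷_; _++_; length; map; filter; concatMap; lookup; tabulate; take; upTo; allFin; replicate)
open import Data.List.Membership.Propositional using (_∈_; _∉_; find; lose)
open import Data.List.Membership.Propositional.Properties
open import Data.List.Properties using (length-++; length-map; length-tabulate; length-take; filter-accept)
open import Data.List.Relation.Unary.All as All using (All; []; _∷_)
import Data.List.Relation.Unary.All.Properties as Allₚ
open import Data.List.Relation.Unary.AllPairs as AllPairs using (AllPairs; []; _∷_; allPairs?)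
import Data.List.Relation.Unary.AllPairs.Properties as AllPairsₚ
open import Data.List.Relation.Unary.Any as Any using (Any; here; there; any?)
open import Data.List.Relation.Unary.Any.Properties using (lookup-index; ¬Any[])
import Data.List.Relation.Unary.Unique.DecPropositional as UniqueDec
open import Data.List.Relation.Unary.Unique.Propositional using (Unique)
import Data.List.Relation.Unary.Unique.Propositional.Properties as Uniqueₚ
open import Data.Nat using (ℕ; zero; suc; _+_; _*_; _∸_; _≤_; _<_; z≤n; s≤s; _≤?_; _<?_; _≡ᵇ_; _%_)
open import Data.Nat.ListAction using (sum)
open import Data.Nat.Properties hiding (_≟_) renaming (suc-injective to ℕ-suc-injective)
open import Algebra.Properties.CommutativeSemigroup +-commutativeSemigroup using (interchange)
open import Data.Nat.Solver using (module +-*-Solver)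
open import Data.Product using (_×_; _,_; ∃-syntax; proj₁; proj₂)
open import Data.Sum using (_⊎_; inj₁; inj₂; [_,_]′)
open import Data.Vec as Vec using ([]; _∷_)
import Data.Vec.Properties as Vecₚ
open import Defs
open import Function using (_∘_; id)
open import Relation.Binary using (Symmetric; DecidableEquality)
open import Relation.Binary.PropositionalEquality using (_≡_; _≢_; refl; sym; trans; cong; cong₂; subst; ≢-sym)
open import Relation.Nullary using (¬_; Dec; yes; no; contradiction)
open import Relation.Nullary.Decidable using (map′; _×-dec_; _⊎-dec_; _→-dec_; ¬?; decidable-stable; toSum; from-yes)
open import Relation.Unary using (Decidable)

private variable
  X Y : Set

-- Counting in lists

∑ : List X → (X → ℕ) → ℕ
∑ xs f = sum (map f xs)

∑-mono : ∀ (xs : List X) {f g : X → ℕ} → (∀ {x} → x ∈ xs → f x ≤ g x) → ∑ xs f ≤ ∑ xs g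
∑-mono []       f≤g = z≤n
∑-mono (x ∷ xs) f≤g = +-mono-≤ (f≤g (here refl)) (∑-mono xs (f≤g ∘ there))

∑-+ : ∀ (xs : List X) {f g : X → ℕ} → ∑ xs (λ x → f x + g x) ≡ ∑ xs f + ∑ xs g
∑-+ []               = refl
∑-+ (x ∷ xs) {f} {g} =
  trans (cong ((f x + g x) +_) (∑-+ xs)) (interchange (f x) (g x) (∑ xs f) (∑ xs g))

∑-const : ∀ (xs : List X) c → ∑ xs (λ _ → c) ≡ length xs * c
∑-const []       c = refl
∑-const (x ∷ xs) c = cong (c +_) (∑-const xs c)

∑-swap : ∀ (xs : List X) (ys : List Y) (f : X → Y → ℕ) →
         ∑ xs (λ x → ∑ ys (f x)) ≡ ∑ ys (λ y → ∑ xs (λ x → f x y))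
∑-swap []       ys f = sym (trans (∑-const ys 0) (*-zeroʳ (length ys)))
∑-swap (x ∷ xs) ys f = trans (cong (∑ ys (f x) +_) (∑-swap xs ys f)) (sym (∑-+ ys))

∑-concatMap : ∀ (xs : List X) (g : X → List Y) {f : Y → ℕ} →
              ∑ (concatMap g xs) f ≡ ∑ xs (λ x → ∑ (g x) f)
∑-concatMap []       g     = refl
∑-concatMap (x ∷ xs) g {f} = trans (∑-++ (g x)) (cong (∑ (g x) f +_) (∑-concatMap xs g))
  where
  ∑-++ : ∀ ys {zs} → ∑ (ys ++ zs) f ≡ ∑ ys f + ∑ zs f
  ∑-++ []       = refl
  ∑-++ (y ∷ ys) = trans (cong (f y +_) (∑-++ ys)) (sym (+-assoc (f y) _ _))

count : {P : X → Set} → Decidable P → List X → ℕ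
count P? xs = length (filter P? xs)

indicator : {P : Set} → Dec P → ℕ
indicator (yes _) = 1
indicator (no  _) = 0

count≡∑ : {P : X → Set} (P? : Decidable P) (xs : List X) → count P? xs ≡ ∑ xs (indicator ∘ P?)
count≡∑ P? []       = refl
count≡∑ P? (x ∷ xs) with P? x
... | yes _ = cong suc (count≡∑ P? xs)
... | no  _ = count≡∑ P? xs

∑-cong : ∀ (xs : List X) {f g : X → ℕ} → (∀ x → f x ≡ g x) → ∑ xs f ≡ ∑ xs g
∑-cong []       f≡g = refl
∑-cong (x ∷ xs) f≡g = cong₂ _+_ (f≡g x) (∑-cong xs f≡g)

double-count : {R : X → Y → Set} (R? : ∀ x y → Dec (R x y)) (xs : List X) (ys : List Y) →
               ∑ xs (λ x → count (R? x) ys) ≡ ∑ ys (λ y → count (λ x → R? x y) xs)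
double-count R? xs ys =
  trans (∑-cong xs λ x → count≡∑ (R? x) ys)
  (trans (∑-swap xs ys _)
  (∑-cong ys λ y → sym (count≡∑ (λ x → R? x y) xs)))

count-⊎ : {P Q : X → Set} (P? : Decidable P) (Q? : Decidable Q) (xs : List X) →
          (∀ {x} → x ∈ xs → P x ⊎ Q x) → length xs ≤ count P? xs + count Q? xs
count-⊎ P? Q? []       P⊎Q = z≤n
count-⊎ P? Q? (x ∷ xs) P⊎Q with P? x | Q? x | count-⊎ P? Q? xs (P⊎Q ∘ there)
... | yes _ | yes _ | ih = s≤s (≤-trans ih (+-monoʳ-≤ (count P? xs) (n≤1+n _)))
... | yes _ | no  _ | ih = s≤s ih
... | no  _ | yes _ | ih = subst (suc (length xs) ≤_) (sym (+-suc _ _)) (s≤s ih)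
... | no ¬p | no ¬q | _  = ⊥-elim ([ ¬p , ¬q ]′ (P⊎Q (here refl)))

⊆⇒length≤ : {xs ys : List X} → Unique xs → (∀ {x} → x ∈ xs → x ∈ ys) → length xs ≤ length ys
⊆⇒length≤ {xs = []}     _ _ = z≤n
⊆⇒length≤ {xs = x ∷ xs} (x∉xs ∷ xs!) xs⊆ys with ∈-∃++ (xs⊆ys (here refl))
... | as , bs , refl = begin
  suc (length xs)              ≤⟨ s≤s (⊆⇒length≤ xs! xs⊆as++bs) ⟩
  suc (length (as ++ bs))      ≡⟨ cong suc (length-++ as) ⟩
  suc (length as + length bs)  ≡⟨ +-suc (length as) (length bs) ⟨
  length as + suc (length bs)  ≡⟨ length-++ as ⟨
  length (as ++ x ∷ bs)        ∎
  where
  open ≤-Reasoning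
  xs⊆as++bs : ∀ {z} → z ∈ xs → z ∈ as ++ bs
  xs⊆as++bs z∈xs with ∈-++⁻ as (xs⊆ys (there z∈xs))
  ... | inj₁ z∈as         = ∈-++⁺ˡ z∈as
  ... | inj₂ (here refl)  = contradiction refl (All.lookup x∉xs z∈xs)
  ... | inj₂ (there z∈bs) = ∈-++⁺ʳ as z∈bs

all-equal⇒length≤1 : {xs : List X} → Unique xs → (∀ {x y} → x ∈ xs → y ∈ xs → x ≡ y) → length xs ≤ 1
all-equal⇒length≤1 {xs = []}         _                _  = z≤n
all-equal⇒length≤1 {xs = x ∷ []}     _                _  = s≤s z≤n
all-equal⇒length≤1 {xs = x ∷ y ∷ xs} ((x≢y ∷ _) ∷ _) eq = contradiction (eq (here refl) (there (here refl))) x≢y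

nonempty⇒∃ : {xs : List X} → 1 ≤ length xs → ∃[ x ] x ∈ xs
nonempty⇒∃ {xs = x ∷ _} _ = x , here refl

∃⇒nonempty : {xs : List X} {x : X} → x ∈ xs → 1 ≤ length xs
∃⇒nonempty {xs = _ ∷ _} _ = s≤s z≤n

AllPairs-lookup : {R : X → X → Set} → Symmetric R → {xs : List X} → AllPairs R xs →
                  ∀ {x y} → x ∈ xs → y ∈ xs → x ≢ y → R x y
AllPairs-lookup R-sym (_  ∷ _)   (here refl) (here refl) x≢y = contradiction refl x≢y
AllPairs-lookup R-sym (Rx ∷ _)   (here refl) (there y∈) x≢y = All.lookup Rx y∈
AllPairs-lookup R-sym (Rx ∷ _)   (there x∈)  (here refl) x≢y = R-sym (All.lookup Rx x∈)
AllPairs-lookup R-sym (_  ∷ Rxs) (there x∈)  (there y∈) x≢y = AllPairs-lookup R-sym Rxs x∈ y∈ x≢y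

-- Only finitely many lists of length `t` over `E` exist, so a nested search decides. Missability,
-- the presence of a sunflower and the attainment of a size become decidable this way.
∃List? : {R : List X → Set} → Decidable R → (E : List X) → ∀ t →
         Dec (∃[ M ] length M ≡ t × All (_∈ E) M × R M)
∃List? {R = R} R? E zero = map′ (λ r → [] , refl , [] , r) (λ where ([] , _ , _ , r) → r) (R? [])
∃List? {X = X} {R = R} R? E (suc t) = map′ to from (any? (λ e → ∃List? (λ M → R? (e ∷ M)) E t) E)
  where
  Starting : X → Set
  Starting e = ∃[ M ] length M ≡ t × All (_∈ E) M × R (e ∷ M)
  to : Any Starting E → ∃[ M ] length M ≡ suc t × All (_∈ E) M × R M
  to p with find p
  ... | e , e∈E , M , l , M⊆E , r = e ∷ M , cong suc l , e∈E ∷ M⊆E , r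
  from : ∃[ M ] length M ≡ suc t × All (_∈ E) M × R M → Any Starting E
  from (e ∷ M , l , e∈E ∷ M⊆E , r) = lose e∈E (M , ℕ-suc-injective l , M⊆E , r)

module _ {R : List X → Set} (R? : Decidable R) (R[] : R []) (E : List X) where

  -- Descends from the a priori bound `t`: if no list has that length, the bound drops by one.
  maximum-list : ∀ t → (∀ M → All (_∈ E) M → R M → length M ≤ t) →
                 ∃[ M ] All (_∈ E) M × R M × length M ≤ t ×
                   (∀ N → All (_∈ E) N → R N → length N ≤ length M)
  maximum-list t bound with ∃List? R? E t
  ... | yes (M , refl , M⊆E , r) = M , M⊆E , r , ≤-refl , bound
  maximum-list zero    bound | no ¬M = [] , [] , R[] , z≤n , bound
  maximum-list (suc t) bound | no ¬M =
    let M , M⊆E , r , M≤t , max = maximum-list t (λ N N⊆E rN →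
          ≤-pred (≤∧≢⇒< (bound N N⊆E rN) λ l → ¬M (N , l , N⊆E , rN)))
    in M , M⊆E , r , m≤n⇒m≤1+n M≤t , max

-- Matchings and Gallai's lemma

-- An edge is a label carrying a list of vertices, so that the link of a point can keep the labels
-- and change only `els`.
module Hypergraph {X V : Set} (_≟ˣ_ : DecidableEquality X) (_≟_ : DecidableEquality V)
                  (els : X → List V) where

  open import Data.List.Membership.DecPropositional _≟_ using (_∈?_)

  DisjointEdges : X → X → Set
  DisjointEdges e f = ∀ v → v ∈ els e → v ∉ els f

  disjoint? : ∀ e f → Dec (DisjointEdges e f)
  disjoint? e f = map′
    (λ ¬any v v∈e v∈f → ¬any (lose v∈e v∈f))
    (λ e#f any → let _ , v∈e , v∈f = find any in e#f _ v∈e v∈f)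
    (¬? (any? (_∈? els f) (els e)))

  Matching : List X → Set
  Matching = AllPairs DisjointEdges

  matching? : Decidable Matching
  matching? = allPairs? disjoint?

  V[_] : List X → List V
  V[ M ] = concatMap els M

  covered⁺ : ∀ {M e v} → e ∈ M → v ∈ els e → v ∈ V[ M ]
  covered⁺ e∈M v∈e = ∈-concatMap⁺ els (lose e∈M v∈e)

  covered⁻ : ∀ {M v} → v ∈ V[ M ] → ∃[ e ] e ∈ M × v ∈ els e
  covered⁻ {M} v∈M = find (∈-concatMap⁻ els {xs = M} v∈M)

  matching-∷ : ∀ {e N} → Matching N → (∀ {v} → v ∈ els e → v ∉ V[ N ]) → Matching (e ∷ N)
  matching-∷ N! e#N = All.tabulate (λ f∈N v v∈e v∈f → e#N v∈e (covered⁺ f∈N v∈f)) ∷ N!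

  shared⇒≡ : ∀ {M e f v} → Matching M → e ∈ M → f ∈ M → v ∈ els e → v ∈ els f → e ≡ f
  shared⇒≡ {e = e} {f} M! e∈M f∈M v∈e v∈f with e ≟ˣ f
  ... | yes e≡f = e≡f
  ... | no  e≢f = ⊥-elim (AllPairs-lookup {R = DisjointEdges} (λ x#y v p q → x#y v q p) M! e∈M f∈M e≢f _ v∈e v∈f)

  record Uniform (k : ℕ) (E : List X) : Set where
    field
      distinct : Unique E
      simple   : ∀ {e} → e ∈ E → Unique (els e)
      size     : ∀ {e} → e ∈ E → length (els e) ≡ k
      ext      : ∀ {e f} → e ∈ E → f ∈ E → (∀ {v} → v ∈ els e → v ∈ els f) → e ≡ f

  restrict : ∀ {k E} {P : X → Set} (P? : Decidable P) → Uniform k E → Uniform k (filter P? E)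
  restrict P? U = record
    { distinct = Uniqueₚ.filter⁺ P? distinct
    ; simple   = simple ∘ proj₁ ∘ ∈-filter⁻ P?
    ; size     = size ∘ proj₁ ∘ ∈-filter⁻ P?
    ; ext      = λ e∈ f∈ → ext (proj₁ (∈-filter⁻ P? e∈)) (proj₁ (∈-filter⁻ P? f∈))
    }
    where open Uniform U

  module _ {k E} (U : Uniform k E) where
    open Uniform U

    length-V : ∀ {M} → All (_∈ E) M → length V[ M ] ≡ length M * k
    length-V []           = refl
    length-V {e ∷ M} (e∈E ∷ M⊆E) = trans (length-++ (els e)) (cong₂ _+_ (size e∈E) (length-V M⊆E))

    unique-V : ∀ {M} → All (_∈ E) M → Matching M → Unique V[ M ]
    unique-V M⊆E M! = Uniqueₚ.concat⁺ (Allₚ.map⁺ (All.map simple M⊆E)) (AllPairsₚ.map⁺ (AllPairs.map (λ e#f {v} (p , q) → e#f v p q) M!))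

  -- An empty edge would be disjoint from itself, hence the size `suc k`.
  matching-distinct : ∀ {k E M} → Uniform (suc k) E → All (_∈ E) M → Matching M → Unique M
  matching-distinct U []          []        = []
  matching-distinct U (e∈E ∷ M⊆E) (e# ∷ M!) =
    All.map (λ { e#e refl →
      let v , v∈e = nonempty⇒∃ (≤-trans (s≤s z≤n) (≤-reflexive (sym (Uniform.size U e∈E))))
      in e#e v v∈e v∈e }) e# ∷
    matching-distinct U M⊆E M!

  degree : V → List X → ℕ
  degree v = count (λ e → v ∈? els e)

  open import Data.List.Membership.DecPropositional _≟ˣ_ using () renaming (_∈?_ to _∈ˣ?_)

  filter⊆ : ∀ {P : X → Set} (P? : Decidable P) {M E} → All (_∈ E) M → All (_∈ E) (filter P? M)
  filter⊆ P? M⊆E = All.tabulate (All.lookup M⊆E ∘ proj₁ ∘ ∈-filter⁻ P?)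

  module MaximumMatchings {E : List X} (U : Uniform 2 E) (t : ℕ)
    (bound : ∀ M → All (_∈ E) M → Matching M → length M ≤ t) where
    open Uniform U

    -- If no matching reaches `t`, nothing is `Maximum`; the induction below therefore first lowers
    -- its bound to the true matching number.
    Maximum : List X → Set
    Maximum M = length M ≡ t × All (_∈ E) M × Matching M

    maximum : ∀ {M} → All (_∈ E) M → Matching M → t ≤ length M → Maximum M
    maximum M⊆E M! t≤M = ≤-antisym (bound _ M⊆E M!) t≤M , M⊆E , M!

    Missable : V → Set
    Missable v = ∃[ M ] Maximum M × v ∉ V[ M ]

    MissedBoth : V → V → Set
    MissedBoth u v = ∃[ M ] Maximum M × u ∉ V[ M ] × v ∉ V[ M ]

    missable? : Decidable Missable
    missable? v = map′
      (λ (M , l , M⊆E , M! , v∉) → M , (l , M⊆E , M!) , v∉)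
      (λ (M , (l , M⊆E , M!) , v∉) → M , l , M⊆E , M! , v∉)
      (∃List? (λ M → matching? M ×-dec ¬? (v ∈? V[ M ])) E t)

    missedBoth? : ∀ u v → Dec (MissedBoth u v)
    missedBoth? u v = map′
      (λ (M , l , M⊆E , M! , v∉) → M , (l , M⊆E , M!) , v∉)
      (λ (M , (l , M⊆E , M!) , v∉) → M , l , M⊆E , M! , v∉)
      (∃List? (λ M → matching? M ×-dec (¬? (u ∈? V[ M ]) ×-dec ¬? (v ∈? V[ M ]))) E t)

    extension-⊥ : ∀ {M e} → Maximum M → e ∈ E → (∀ {v} → v ∈ els e → v ∉ V[ M ]) → ⊥
    extension-⊥ (l , M⊆E , M!) e∈E e#M =
      1+n≰n (subst (λ s → suc s ≤ t) l (bound _ (e∈E ∷ M⊆E) (matching-∷ M! e#M)))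

    other-end : ∀ {e x} → e ∈ E → x ∈ els e →
                ∃[ y ] y ∈ els e × y ≢ x × (∀ {z} → z ∈ els e → z ≡ x ⊎ z ≡ y)
    other-end {e} {x} e∈E x∈e = go (els e) (size e∈E) (simple e∈E) x∈e
      where
      go : ∀ xs → length xs ≡ 2 → Unique xs → x ∈ xs →
           ∃[ y ] y ∈ xs × y ≢ x × (∀ {z} → z ∈ xs → z ≡ x ⊎ z ≡ y)
      go (a ∷ b ∷ []) refl ((a≢b ∷ _) ∷ _) (here refl) =
        b , there (here refl) , a≢b ∘ sym ,
        λ { (here p) → inj₁ p ; (there (here p)) → inj₂ p }
      go (a ∷ b ∷ []) refl ((a≢b ∷ _) ∷ _) (there (here refl)) =
        a , here refl , a≢b ,
        λ { (here p) → inj₂ p ; (there (here p)) → inj₁ p }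

    -- Otherwise `e` would extend a maximum matching that misses both of its ends.
    adjacent-not-missed : ∀ {e x y} → e ∈ E → x ∈ els e → y ∈ els e → x ≢ y → ¬ MissedBoth x y
    adjacent-not-missed e∈E x∈e y∈e x≢y (M , mx , x∉ , y∉) with other-end e∈E x∈e
    ... | y′ , _ , _ , ends with ends y∈e
    ... | inj₁ y≡x  = x≢y (sym y≡x)
    ... | inj₂ refl = extension-⊥ mx e∈E λ z∈e → [ (λ { refl → x∉ }) , (λ { refl → y∉ }) ]′ (ends z∈e)

    -- Gallai's lemma.  If M covers v and N covers u and w, then M covers a second
    -- point x missed by N.  The edge of M at x then replaces an edge of N, which
    -- enlarges M ∩ N; the fuel s bounds how often this can happen.
    missedBoth-split : ∀ {u v w} → u ≢ w → ∀ s M N → t < s + count (_∈ˣ? M) N →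
                       Maximum M → u ∉ V[ M ] → w ∉ V[ M ] → Maximum N → v ∉ V[ N ] →
                       MissedBoth u v ⊎ MissedBoth v w
    missedBoth-split {u} {v} {w} u≢w s M N fuel mM@(lM , M⊆E , M!) u∉M w∉M mN@(lN , N⊆E , N!) v∉N
      with v ∈? V[ M ] | u ∈? V[ N ] | w ∈? V[ N ]
    ... | no v∉M  | _       | _       = inj₁ (M , mM , u∉M , v∉M)
    ... | yes _   | no u∉N  | _       = inj₁ (N , mN , u∉N , v∉N)
    ... | yes _   | yes _   | no w∉N  = inj₂ (N , mN , v∉N , w∉N)
    ... | yes v∈M | yes u∈N | yes w∈N = closer s fuel
      where
      open ≤-Reasoning
      -- Both matchings cover `2t` vertices. If `N` covered the `2t - 1` vertices of `M` other than
      -- `v`, then with `u` and `w` it would cover `2t + 1`.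
      escapee : ∃[ x ] x ∈ V[ M ] × x ≢ v × x ∉ V[ N ]
      escapee with any? (λ x → ¬? (x ≟ v) ×-dec ¬? (x ∈? V[ N ])) V[ M ]
      ... | yes p = find p
      ... | no ¬p = contradiction too-many 1+n≰n
        where
        rest = filter (λ x → ¬? (x ≟ v)) V[ M ]
        rest⊆M : ∀ {z} → z ∈ rest → z ∈ V[ M ]
        rest⊆M = proj₁ ∘ ∈-filter⁻ (λ x → ¬? (x ≟ v))
        uw∷rest! : Unique (u ∷ w ∷ rest)
        uw∷rest! =
          (u≢w ∷ All.tabulate (λ z∈ u≡z → u∉M (subst (_∈ V[ M ]) (sym u≡z) (rest⊆M z∈)))) ∷
          All.tabulate (λ z∈ w≡z → w∉M (subst (_∈ V[ M ]) (sym w≡z) (rest⊆M z∈))) ∷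
          Uniqueₚ.filter⁺ _ (unique-V U M⊆E M!)
        uw∷rest⊆N : ∀ {z} → z ∈ u ∷ w ∷ rest → z ∈ V[ N ]
        uw∷rest⊆N (here refl)         = u∈N
        uw∷rest⊆N (there (here refl)) = w∈N
        uw∷rest⊆N {z} (there (there z∈)) = decidable-stable (z ∈? V[ N ]) λ z∉N →
          let z∈M , z≢v = ∈-filter⁻ (λ x → ¬? (x ≟ v)) z∈ in ¬p (lose z∈M (z≢v , z∉N))
        M⊆v∷rest : ∀ {z} → z ∈ V[ M ] → z ∈ v ∷ rest
        M⊆v∷rest {z} z∈M with z ≟ v
        ... | yes refl = here refl
        ... | no  z≢v  = there (∈-filter⁺ (λ x → ¬? (x ≟ v)) z∈M z≢v)
        too-many : suc (length V[ M ]) ≤ length V[ M ]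
        too-many = begin
          suc (length V[ M ])   ≤⟨ s≤s (⊆⇒length≤ (unique-V U M⊆E M!) M⊆v∷rest) ⟩
          suc (suc (length rest)) ≤⟨ ⊆⇒length≤ uw∷rest! uw∷rest⊆N ⟩
          length V[ N ]         ≡⟨ length-V U N⊆E ⟩
          length N * 2          ≡⟨ cong (_* 2) (trans lN (sym lM)) ⟩
          length M * 2          ≡⟨ length-V U M⊆E ⟨
          length V[ M ]         ∎
      closer : ∀ s → t < s + count (_∈ˣ? M) N → MissedBoth u v ⊎ MissedBoth v w
      -- `N` has `t` edges and cannot share more than `t` with `M`.
      closer zero    t<count = contradiction
        (≤-trans (⊆⇒length≤ (Uniqueₚ.filter⁺ (_∈ˣ? M) (matching-distinct U N⊆E N!)) (proj₁ ∘ ∈-filter⁻ (_∈ˣ? M) {xs = N})) (≤-reflexive lN))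
        (<⇒≱ t<count)
      closer (suc s) fuel with escapee
      ... | x , x∈M , x≢v , x∉N with covered⁻ {M} x∈M
      ... | e , e∈M , x∈e with other-end (All.lookup M⊆E e∈M) x∈e
      ... | y , y∈e , y≢x , ends with y ∈? V[ N ]
      ... | no y∉N = ⊥-elim (adjacent-not-missed (All.lookup M⊆E e∈M) y∈e x∈e y≢x (N , mN , y∉N , x∉N))
      ... | yes y∈N with covered⁻ {N} y∈N
      ... | f , f∈N , y∈f =
        missedBoth-split u≢w s M N′ fuel′ mM u∉M w∉M (maximum N′⊆E N′! t≤N′) v∉N′
        where
        ≢f? = λ g → ¬? (g ≟ˣ f)
        N⁻ = filter ≢f? N
        N′ = e ∷ N⁻
        N⁻⊆N : ∀ {g} → g ∈ N⁻ → g ∈ N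
        N⁻⊆N = proj₁ ∘ ∈-filter⁻ ≢f?
        N′⊆E : All (_∈ E) N′
        N′⊆E = All.lookup M⊆E e∈M ∷ filter⊆ ≢f? N⊆E
        N′! : Matching N′
        N′! = matching-∷ (AllPairsₚ.filter⁺ ≢f? N!) e#
          where
          e# : ∀ {z} → z ∈ els e → z ∉ V[ N⁻ ]
          e# z∈e z∈N⁻ with covered⁻ {N⁻} z∈N⁻ | ends z∈e
          ... | g , g∈ , z∈g | inj₁ refl = x∉N (covered⁺ (N⁻⊆N g∈) z∈g)
          ... | g , g∈ , z∈g | inj₂ refl = proj₂ (∈-filter⁻ ≢f? {xs = N} g∈) (shared⇒≡ N! (N⁻⊆N g∈) f∈N z∈g y∈f)
        N⊆f∷N⁻ : ∀ {g} → g ∈ N → g ∈ f ∷ N⁻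
        N⊆f∷N⁻ {g} g∈N with g ≟ˣ f
        ... | yes g≡f = here g≡f
        ... | no  g≢f = there (∈-filter⁺ ≢f? g∈N g≢f)
        -- The edge of `M` at `y` is `e`, which contains `x`, whereas `f` lies in `N`, which misses
        -- `x`.
        f∉M : f ∉ M
        f∉M f∈M with shared⇒≡ M! f∈M e∈M y∈f y∈e
        ... | refl = x∉N (covered⁺ f∈N x∈e)
        t≤N′ : t ≤ length N′
        t≤N′ = subst (_≤ length N′) lN (⊆⇒length≤ (matching-distinct U N⊆E N!) N⊆f∷N⁻)
        v∉N′ : v ∉ V[ N′ ]
        v∉N′ v∈N′ with covered⁻ {N′} v∈N′
        ... | g , there g∈ , v∈g = v∉N (covered⁺ (N⁻⊆N g∈) v∈g)
        ... | g , here refl , v∈e with ends v∈e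
        ... | inj₁ v≡x  = x≢v (sym v≡x)
        ... | inj₂ refl = v∉N y∈N
        -- Removing `f` loses no edge common with `M`, and `e` adds one.
        fuel′ : t < s + count (_∈ˣ? M) N′
        fuel′ = begin-strict
          t                              <⟨ fuel ⟩
          suc s + count (_∈ˣ? M) N       ≤⟨ s≤s (+-monoʳ-≤ s (⊆⇒length≤
                                              (Uniqueₚ.filter⁺ (_∈ˣ? M) (matching-distinct U N⊆E N!)) N∩M⊆N⁻)) ⟩
          suc s + count (_∈ˣ? M) N⁻      ≡⟨ +-suc s _ ⟨
          s + suc (count (_∈ˣ? M) N⁻)    ≡⟨ cong (λ l → s + length l) (filter-accept (_∈ˣ? M) e∈M) ⟨
          s + count (_∈ˣ? M) N′          ∎
          where
          N∩M⊆N⁻ : ∀ {g} → g ∈ filter (_∈ˣ? M) N → g ∈ filter (_∈ˣ? M) N⁻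
          N∩M⊆N⁻ g∈ with ∈-filter⁻ (_∈ˣ? M) {xs = N} g∈
          ... | g∈N , g∈M = ∈-filter⁺ (_∈ˣ? M) (∈-filter⁺ ≢f? g∈N λ { refl → f∉M g∈M }) g∈M

  ∑-degree : ∀ E W → ∑ E (λ e → count (_∈? els e) W) ≡ ∑ W (λ w → degree w E)
  ∑-degree E W = double-count (λ e w → w ∈? els e) E W

-- Graphs of maximum degree at most 5

-- This is 5t + 2⌊t/3⌋. The increment 17 = ⌊7 · 5 / 2⌋ is the most that degree 5 allows on the 7
-- vertices of a class with 3 matching edges.
edgeBound : ℕ → ℕ
edgeBound 0 = 0
edgeBound 1 = 5
edgeBound 2 = 10
edgeBound (suc (suc (suc t))) = 17 + edgeBound t

-- Pays for deleting a vertex that lies in every maximum matching: at most 5 edges go and the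
-- matching number drops.
edgeBound-suc : ∀ t → 5 + edgeBound t ≤ edgeBound (suc t)
edgeBound-suc 0 = ≤-refl
edgeBound-suc 1 = ≤-refl
edgeBound-suc 2 = m≤m+n 15 2
edgeBound-suc (suc (suc (suc t))) = +-monoʳ-≤ 17 (edgeBound-suc t)

edgeBound-mono : ∀ {s t} → s ≤ t → edgeBound s ≤ edgeBound t
edgeBound-mono {t = t} z≤n = z≤n
edgeBound-mono {suc s} {suc t} s≤t with m≤n⇒m<n∨m≡n s≤t
... | inj₂ refl = ≤-refl
... | inj₁ (s≤s s<t) = ≤-trans (edgeBound-mono s<t) (≤-trans (m≤n+m _ 5) (edgeBound-suc t))

5*≤edgeBound : ∀ m → 5 * m ≤ edgeBound m
5*≤edgeBound 0 = z≤n
5*≤edgeBound (suc m) = begin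
  5 * suc m          ≡⟨ *-suc 5 m ⟩
  5 + 5 * m          ≤⟨ +-monoʳ-≤ 5 (5*≤edgeBound m) ⟩
  5 + edgeBound m    ≤⟨ edgeBound-suc m ⟩
  edgeBound (suc m)  ∎
  where open ≤-Reasoning

-- Combines the bounds for a class and for the rest of the graph.
edgeBound-+ : ∀ m k → edgeBound m + edgeBound k ≤ edgeBound (m + k)
edgeBound-+ 0 k = ≤-refl
edgeBound-+ 1 k = edgeBound-suc k
edgeBound-+ 2 k = ≤-trans (+-monoʳ-≤ 5 (edgeBound-suc k)) (edgeBound-suc (suc k))
edgeBound-+ (suc (suc (suc m))) k = +-monoʳ-≤ 17 (edgeBound-+ m k)

-- The c edges live on 2m + 1 vertices, each with at most 5 and at most 2m neighbours.
component-bound : ∀ m c → c * 2 ≤ suc (m * 2) * 5 → c * 2 ≤ suc (m * 2) * (m * 2) → c ≤ edgeBound m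
component-bound 0 c _ 2c≤0 = *-cancelʳ-≤ c 0 2 2c≤0
-- For `m` equal to 1 or 2 the degree bound 5 would still allow 7 or 12 edges, so the bound by `2m`
-- neighbours is used.
component-bound 1 c _ 2c≤6 = ≤-trans (*-cancelʳ-≤ c 3 2 2c≤6) (m≤m+n 3 2)
component-bound 2 c _ 2c≤20 = *-cancelʳ-≤ c 10 2 2c≤20
component-bound (suc (suc (suc m))) c 2c≤ _ = ≤-trans
  -- By parity, `2c ≤ 35 + 10m` gives `c ≤ 17 + 5m`.
  (≤-pred (*-cancelʳ-< 2 c (suc (17 + 5 * m)) (begin-strict
    c * 2                            ≤⟨ 2c≤ ⟩
    suc (suc (suc (suc m)) * 2) * 5  ≡⟨ solve 1 (λ m → (con 7 :+ m :* con 2) :* con 5 := con 35 :+ con 10 :* m) refl m ⟩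
    35 + 10 * m                      <⟨ n<1+n _ ⟩
    36 + 10 * m                      ≡⟨ solve 1 (λ m → con 36 :+ con 10 :* m := (con 18 :+ con 5 :* m) :* con 2) refl m ⟩
    (18 + 5 * m) * 2                 ∎)))
  (+-monoʳ-≤ 17 (5*≤edgeBound m))
  where
  open ≤-Reasoning
  open +-*-Solver

module Graph {X V : Set} (_≟ˣ_ : DecidableEquality X) (_≟_ : DecidableEquality V)
             (els : X → List V) where
  open Hypergraph _≟ˣ_ _≟_ els
  open import Data.List.Membership.DecPropositional _≟_ using (_∈?_)

  -- Splitting off one Gallai class

  module Component {E : List X} (U : Uniform 2 E) (Δ≤5 : ∀ v → degree v E ≤ 5) (t : ℕ)
    (bound : ∀ M → All (_∈ E) M → Matching M → length M ≤ t)
    (missable : ∀ {v} → v ∈ V[ E ] → MaximumMatchings.Missable U t bound v)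
    {e₀ : X} (e₀∈E : e₀ ∈ E) {u : V} (u∈e₀ : u ∈ els e₀) where
    open Uniform U
    open MaximumMatchings U t bound
    open ≤-Reasoning

    -- The vertex `u` is added by hand: being missable, it satisfies `MissedBoth u u`.
    Class : V → Set
    Class v = v ≡ u ⊎ ¬ MissedBoth u v

    class? : Decidable Class
    class? v = v ≟ u ⊎-dec ¬? (missedBoth? u v)

    -- If `y` were outside the class, some `M` would miss `u` and `y`. With an `N` missing `x`,
    -- Gallai's lemma gives a maximum matching that misses `u` and `x`, against the class of `x`, or
    -- `x` and `y`, against adjacency.
    class-closed : ∀ {e x y} → e ∈ E → x ∈ els e → y ∈ els e → Class x → Class y
    class-closed {e} {x} {y} e∈E x∈e y∈e Cx with x ≟ y | y ≟ u | missedBoth? u y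
    ... | yes refl | _       | _       = Cx
    ... | no _     | yes y≡u | _       = inj₁ y≡u
    ... | no _     | no _    | no ¬uy  = inj₂ ¬uy
    ... | no x≢y   | no y≢u  | yes uy@(M , mM , u∉M , y∉M) with Cx
    ... | inj₁ refl = ⊥-elim (adjacent-not-missed e∈E x∈e y∈e x≢y uy)
    ... | inj₂ ¬ux with missable (covered⁺ e∈E x∈e)
    ... | N , mN , x∉N with missedBoth-split (y≢u ∘ sym) (suc t) M N (m≤m+n _ _) mM u∉M y∉M mN x∉N
    ... | inj₁ ux = contradiction ux ¬ux
    ... | inj₂ xy = ⊥-elim (adjacent-not-missed e∈E x∈e y∈e x≢y xy)

    MeetsClass : X → Set
    MeetsClass e = Any Class (els e)

    meetsClass? : Decidable MeetsClass
    meetsClass? e = any? class? (els e)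

    within-class : ∀ {e} → e ∈ E → MeetsClass e → ∀ {y} → y ∈ els e → Class y
    within-class e∈E Ce y∈e = let x , x∈e , Cx = find Ce in class-closed e∈E x∈e y∈e Cx

    M : List X
    M = proj₁ (missable (covered⁺ e₀∈E u∈e₀))
    M-max : Maximum M
    M-max = proj₁ (proj₂ (missable (covered⁺ e₀∈E u∈e₀)))
    u∉M : u ∉ V[ M ]
    u∉M = proj₂ (proj₂ (missable (covered⁺ e₀∈E u∈e₀)))
    M⊆E : All (_∈ E) M
    M⊆E = proj₁ (proj₂ M-max)

    Eᶜ Eʳ Mᶜ : List X
    Eᶜ = filter meetsClass? E
    Eʳ = filter (¬? ∘ meetsClass?) E
    Mᶜ = filter meetsClass? M

    Mᶜ⊆E : All (_∈ E) Mᶜ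
    Mᶜ⊆E = filter⊆ meetsClass? M⊆E

    Mᶜ! : Matching Mᶜ
    Mᶜ! = AllPairsₚ.filter⁺ meetsClass? (proj₂ (proj₂ M-max))

    -- `M` misses `u`, so it covers every other vertex of the class, by edges of `Mᶜ`. Hence `W`
    -- exhausts the class.
    W : List V
    W = u ∷ V[ Mᶜ ]

    length-W : length W ≡ suc (length Mᶜ * 2)
    length-W = cong suc (length-V U Mᶜ⊆E)

    W-unique : Unique W
    W-unique = All.tabulate (λ { v∈ refl → u∉M (let e , e∈ , v∈e = covered⁻ {Mᶜ} v∈
                                                 in covered⁺ (proj₁ (∈-filter⁻ meetsClass? {xs = M} e∈)) v∈e) })
             ∷ unique-V U Mᶜ⊆E Mᶜ!

    class⊆W : ∀ {v} → Class v → v ∈ W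
    class⊆W (inj₁ refl) = here refl
    class⊆W {v} (inj₂ ¬uv) with v ∈? V[ M ]
    ... | no v∉M  = contradiction (M , M-max , u∉M , v∉M) ¬uv
    ... | yes v∈M with covered⁻ {M} v∈M
    ... | e , e∈M , v∈e = there (covered⁺ (∈-filter⁺ meetsClass? e∈M (lose v∈e (inj₂ ¬uv))) v∈e)

    -- Makes the induction progress: the other end of `e₀` belongs to the class and is covered by
    -- `Mᶜ`.
    Mᶜ-nonempty : 1 ≤ length Mᶜ
    Mᶜ-nonempty with other-end e₀∈E u∈e₀
    ... | y , y∈e₀ , y≢u , _ with class⊆W (class-closed e₀∈E u∈e₀ y∈e₀ (inj₁ refl))
    ... | here y≡u  = contradiction y≡u y≢u
    ... | there y∈M = let _ , e∈ , _ = covered⁻ {Mᶜ} y∈M in ∃⇒nonempty e∈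

    Uᶜ : Uniform 2 Eᶜ
    Uᶜ = restrict meetsClass? U

    Eᶜ⊆W : ∀ {e v} → e ∈ Eᶜ → v ∈ els e → v ∈ W
    Eᶜ⊆W e∈ v∈e = let e∈E , Ce = ∈-filter⁻ meetsClass? e∈ in class⊆W (within-class e∈E Ce v∈e)

    degreeᶜ≤5 : ∀ v → degree v Eᶜ ≤ 5
    degreeᶜ≤5 v = ≤-trans (⊆⇒length≤ (Uniqueₚ.filter⁺ (λ e → v ∈? els e) (Uniform.distinct Uᶜ)) Eᶜ∋v⊆E∋v) (Δ≤5 v)
      where
      Eᶜ∋v⊆E∋v : ∀ {e} → e ∈ filter (λ e → v ∈? els e) Eᶜ → e ∈ filter (λ e → v ∈? els e) E
      Eᶜ∋v⊆E∋v e∈ = let e∈Eᶜ , v∈e = ∈-filter⁻ (λ e → v ∈? els e) {xs = Eᶜ} e∈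
                    in ∈-filter⁺ (λ e → v ∈? els e) (proj₁ (∈-filter⁻ meetsClass? {xs = E} e∈Eᶜ)) v∈e

    -- Each edge at `w` has its other end in `W`, and in a simple graph no two edges at `w` share
    -- that end.
    degreeᶜ≤2m : ∀ {w} → w ∈ W → degree w Eᶜ ≤ length Mᶜ * 2
    degreeᶜ≤2m {w} w∈W = begin
      length Eʷ                                ≡⟨ *-identityʳ _ ⟨
      length Eʷ * 1                            ≡⟨ ∑-const Eʷ 1 ⟨
      ∑ Eʷ (λ _ → 1)                           ≤⟨ ∑-mono Eʷ neighbour ⟩
      ∑ Eʷ (λ e → count (_∈? els e) W⁻)        ≡⟨ ∑-degree Eʷ W⁻ ⟩
      ∑ W⁻ (λ z → degree z Eʷ)                 ≤⟨ ∑-mono W⁻ simple-edge ⟩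
      ∑ W⁻ (λ _ → 1)                           ≡⟨ ∑-const W⁻ 1 ⟩
      length W⁻ * 1                            ≡⟨ *-identityʳ _ ⟩
      length W⁻                                ≤⟨ ≤-pred (≤-trans (⊆⇒length≤ w∷W⁻! w∷W⁻⊆W) (≤-reflexive length-W)) ⟩
      length Mᶜ * 2                            ∎
      where
      ∋w? = λ e → w ∈? els e
      ≢w? = λ z → ¬? (z ≟ w)
      Eʷ = filter ∋w? Eᶜ
      W⁻ = filter ≢w? W
      neighbour : ∀ {e} → e ∈ Eʷ → 1 ≤ count (_∈? els e) W⁻
      neighbour {e} e∈ with ∈-filter⁻ ∋w? {xs = Eᶜ} e∈
      ... | e∈Eᶜ , w∈e with other-end (proj₁ (∈-filter⁻ meetsClass? {xs = E} e∈Eᶜ)) w∈e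
      ... | y , y∈e , y≢w , _ =
        ∃⇒nonempty (∈-filter⁺ (_∈? els e) (∈-filter⁺ ≢w? (Eᶜ⊆W e∈Eᶜ y∈e) y≢w) y∈e)
      simple-edge : ∀ {z} → z ∈ W⁻ → degree z Eʷ ≤ 1
      simple-edge {z} z∈ = all-equal⇒length≤1
        (Uniqueₚ.filter⁺ _ (Uniqueₚ.filter⁺ _ (Uniform.distinct Uᶜ))) same
        where
        z≢w = proj₂ (∈-filter⁻ ≢w? {xs = W} z∈)
        same : ∀ {e f} → e ∈ filter (λ e → z ∈? els e) Eʷ → f ∈ filter (λ e → z ∈? els e) Eʷ → e ≡ f
        same e∈ f∈ with ∈-filter⁻ (λ e → z ∈? els e) {xs = Eʷ} e∈ | ∈-filter⁻ (λ e → z ∈? els e) {xs = Eʷ} f∈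
        ... | e∈Eʷ , z∈e | f∈Eʷ , z∈f with ∈-filter⁻ ∋w? {xs = Eᶜ} e∈Eʷ | ∈-filter⁻ ∋w? {xs = Eᶜ} f∈Eʷ
        ... | e∈Eᶜ , w∈e | f∈Eᶜ , w∈f with ∈-filter⁻ meetsClass? {xs = E} e∈Eᶜ | ∈-filter⁻ meetsClass? {xs = E} f∈Eᶜ
        ... | e∈E , _ | f∈E , _ with other-end e∈E w∈e
        ... | y , _ , _ , ends with ends z∈e
        ... | inj₁ z≡w = contradiction z≡w z≢w
        ... | inj₂ refl = ext e∈E f∈E λ v∈e → [ (λ { refl → w∈f }) , (λ { refl → z∈f }) ]′ (ends v∈e)
      w∷W⁻! : Unique (w ∷ W⁻)
      w∷W⁻! = All.tabulate (λ z∈ w≡z → proj₂ (∈-filter⁻ ≢w? {xs = W} z∈) (sym w≡z)) ∷ Uniqueₚ.filter⁺ ≢w? W-unique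
      w∷W⁻⊆W : ∀ {z} → z ∈ w ∷ W⁻ → z ∈ W
      w∷W⁻⊆W (here refl) = w∈W
      w∷W⁻⊆W (there z∈)  = proj₁ (∈-filter⁻ ≢w? z∈)

    length-Eᶜ : length Eᶜ ≤ edgeBound (length Mᶜ)
    length-Eᶜ = component-bound (length Mᶜ) (length Eᶜ)
      (handshake 5 (λ {w} _ → degreeᶜ≤5 w))
      (handshake (length Mᶜ * 2) degreeᶜ≤2m)
      where
      handshake : ∀ d → (∀ {w} → w ∈ W → degree w Eᶜ ≤ d) → length Eᶜ * 2 ≤ suc (length Mᶜ * 2) * d
      handshake d deg≤d = begin
        length Eᶜ * 2                       ≡⟨ ∑-const Eᶜ 2 ⟨
        ∑ Eᶜ (λ _ → 2)                      ≤⟨ ∑-mono Eᶜ both-ends ⟩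
        ∑ Eᶜ (λ e → count (_∈? els e) W)    ≡⟨ ∑-degree Eᶜ W ⟩
        ∑ W (λ w → degree w Eᶜ)             ≤⟨ ∑-mono W deg≤d ⟩
        ∑ W (λ _ → d)                       ≡⟨ ∑-const W d ⟩
        length W * d                        ≡⟨ cong (_* d) length-W ⟩
        suc (length Mᶜ * 2) * d             ∎
        where
        both-ends : ∀ {e} → e ∈ Eᶜ → 2 ≤ count (_∈? els e) W
        both-ends {e} e∈ = subst (_≤ count (_∈? els e) W) (Uniform.size Uᶜ e∈)
          (⊆⇒length≤ (Uniform.simple Uᶜ e∈) λ v∈e → ∈-filter⁺ (_∈? els e) (Eᶜ⊆W e∈ v∈e) v∈e)

    -- The rest touches no edge of `Mᶜ`, so `Mᶜ` extends each of its matchings.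
    boundʳ : ∀ N → All (_∈ Eʳ) N → Matching N → length N ≤ t ∸ length Mᶜ
    boundʳ N N⊆Eʳ N! = m+n≤o⇒m≤o∸n (length N) (subst (_≤ t) (length-++ N)
      (bound (N ++ Mᶜ) (Allₚ.++⁺ (All.map (proj₁ ∘ ∈-filter⁻ (¬? ∘ meetsClass?)) N⊆Eʳ) Mᶜ⊆E)
        (AllPairsₚ.++⁺ N! Mᶜ! (All.map (λ e∈Eʳ → All.tabulate (apart e∈Eʳ)) N⊆Eʳ))))
      where
      apart : ∀ {e f} → e ∈ Eʳ → f ∈ Mᶜ → DisjointEdges e f
      apart e∈Eʳ f∈Mᶜ v v∈e v∈f = proj₂ (∈-filter⁻ (¬? ∘ meetsClass?) {xs = E} e∈Eʳ)
        (lose v∈e (within-class (All.lookup Mᶜ⊆E f∈Mᶜ) (proj₂ (∈-filter⁻ meetsClass? {xs = M} f∈Mᶜ)) v∈f))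

  -- `n` is fuel: splitting off a class recurs at `length M ∸ m`, which is not structurally smaller.
  edges≤edgeBound : ∀ n t → t ≤ n → ∀ {E} → Uniform 2 E → (∀ v → degree v E ≤ 5) →
               (∀ M → All (_∈ E) M → Matching M → length M ≤ t) → length E ≤ edgeBound t
  edges≤edgeBound n t t≤n {[]} U Δ≤5 bound = z≤n
  edges≤edgeBound n t t≤n {E@(e₀ ∷ _)} U Δ≤5 bound with maximum-list matching? [] E t bound
  ... | M , M⊆E , M! , M≤t , bound′ =
    ≤-trans (go n _ (≤-trans M≤t t≤n) refl) (edgeBound-mono M≤t)
    where
    open Uniform U
    open MaximumMatchings U (length M) bound′
    open ≤-Reasoning
    missing? = λ v → ¬? (missable? v)

    degree-restrict : ∀ {P : X → Set} (P? : Decidable P) v → degree v (filter P? E) ≤ 5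
    degree-restrict P? v = ≤-trans (⊆⇒length≤
      (Uniqueₚ.filter⁺ (λ e → v ∈? els e) (Uniqueₚ.filter⁺ P? distinct))
      (λ e∈ → let e∈′ , v∈e = ∈-filter⁻ (λ e → v ∈? els e) {xs = filter P? E} e∈
              in ∈-filter⁺ (λ e → v ∈? els e) (proj₁ (∈-filter⁻ P? e∈′)) v∈e)) (Δ≤5 v)

    go : ∀ n s → s ≤ n → s ≡ length M → length E ≤ edgeBound (length M)
    -- A nonempty graph has a matching with one edge.
    go n zero _ 0≡ = contradiction
      (≤-trans (bound′ (e₀ ∷ []) (here refl ∷ []) ([] ∷ [])) (≤-reflexive (sym 0≡))) 1+n≰n
    go (suc n) (suc s) (s≤s s≤n) 1+s≡M with any? (λ v → ¬? (missable? v)) V[ E ]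
    ... | yes p with find p
    ... | v , v∈E , ¬missable = begin
      length E                                     ≤⟨ count-⊎ ∋v? (¬? ∘ ∋v?) E (λ {e} _ → toSum (∋v? e)) ⟩
      degree v E + length (filter (¬? ∘ ∋v?) E)   ≤⟨ +-mono-≤ (Δ≤5 v) (edges≤edgeBound n s s≤n (restrict (¬? ∘ ∋v?) U) (degree-restrict (¬? ∘ ∋v?)) bound⁻) ⟩
      5 + edgeBound s                              ≤⟨ edgeBound-suc s ⟩
      edgeBound (suc s)                            ≡⟨ cong edgeBound 1+s≡M ⟩
      edgeBound (length M)                         ∎
      where
      ∋v? = λ e → v ∈? els e
      -- A matching that avoids `v` and is as large as `M` would show `v` missable.
      bound⁻ : ∀ N → All (_∈ filter (¬? ∘ ∋v?) E) N → Matching N → length N ≤ s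
      bound⁻ N N⊆ N! = ≤-pred (subst (length N <_) (sym 1+s≡M)
        (≤∧≢⇒< (bound′ N N⊆E N!) λ l → ¬missable (N , (l , N⊆E , N!) , v∉N)))
        where
        N⊆E = All.map (proj₁ ∘ ∈-filter⁻ (¬? ∘ ∋v?)) N⊆
        v∉N : v ∉ V[ N ]
        v∉N v∈N = let e , e∈N , v∈e = covered⁻ {N} v∈N
                  in proj₂ (∈-filter⁻ (¬? ∘ ∋v?) {xs = E} (All.lookup N⊆ e∈N)) v∈e
    go (suc n) (suc s) (s≤s s≤n) 1+s≡M | no ¬p with nonempty⇒∃ (≤-trans (s≤s z≤n) (≤-reflexive (sym (size {e₀} (here refl)))))
    ... | u , u∈e₀ = begin
      length E                                      ≤⟨ count-⊎ meetsClass? (¬? ∘ meetsClass?) E (λ {e} _ → toSum (meetsClass? e)) ⟩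
      length Eᶜ + length Eʳ                         ≤⟨ +-mono-≤ length-Eᶜ
        (edges≤edgeBound n (length M ∸ m) smaller (restrict (¬? ∘ meetsClass?) U) (degree-restrict (¬? ∘ meetsClass?)) boundʳ) ⟩
      edgeBound m + edgeBound (length M ∸ m)        ≤⟨ edgeBound-+ m _ ⟩
      edgeBound (m + (length M ∸ m))                ≡⟨ cong edgeBound (m+[n∸m]≡n (bound′ Mᶜ Mᶜ⊆E Mᶜ!)) ⟩
      edgeBound (length M)                          ∎
      where
      missable : ∀ {v} → v ∈ V[ E ] → Missable v
      missable {v} v∈E = decidable-stable (missable? v) λ ¬m → ¬p (lose v∈E ¬m)
      open Component U Δ≤5 (length M) bound′ missable (here refl) u∈e₀ hiding (M; M⊆E)
      m = length Mᶜ
      smaller : length M ∸ m ≤ n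
      smaller = ≤-trans (∸-monoʳ-≤ (length M) Mᶜ-nonempty) (≤-trans (≤-reflexive (cong (_∸ 1) (sym 1+s≡M))) s≤n)

-- Triple systems without a 6-sunflower

unique⇒AllPairs : ∀ {A : Set} {R : A → A → Set} {xs : List A} → Unique xs →
                  (∀ {x y} → x ∈ xs → y ∈ xs → x ≢ y → R x y) → AllPairs R xs
unique⇒AllPairs []           R! = []
unique⇒AllPairs (x∉ ∷ xs!) R! =
  All.tabulate (λ y∈ → R! (here refl) (there y∈) (All.lookup x∉ y∈)) ∷
  unique⇒AllPairs xs! (λ x∈ y∈ → R! (there x∈) (there y∈))

module _ {A : Set} (_≟_ : DecidableEquality A) where

  length-filter-≢ : ∀ {xs : List A} {v} → Unique xs → v ∈ xs →
                    suc (length (filter (λ x → ¬? (x ≟ v)) xs)) ≡ length xs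
  length-filter-≢ {xs} {v} xs! v∈xs = ≤-antisym
    (⊆⇒length≤ (All.tabulate (λ x∈ v≡x → proj₂ (∈-filter⁻ ≢v? {xs = xs} x∈) (sym v≡x)) ∷ Uniqueₚ.filter⁺ ≢v? xs!)
      λ { (here refl) → v∈xs ; (there x∈) → proj₁ (∈-filter⁻ ≢v? x∈) })
    (⊆⇒length≤ xs! λ {x} x∈ → [ here , there ∘ ∈-filter⁺ ≢v? x∈ ]′ (toSum (x ≟ v)))
    where ≢v? = λ x → ¬? (x ≟ v)

-- Either `b` and `c` vanish, or one of them cuts `a` down to 10 and the sum is at most 12.
private-sum-large : ∀ a b c → a ≤ 22 → b ≤ 1 → c ≤ 1 → (1 ≤ b → a ≤ 10) → (1 ≤ c → a ≤ 10) → a + (b + c) ≤ 22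
private-sum-large a 0 0 a≤ b≤ c≤ b→a c→a = subst (_≤ 22) (sym (+-identityʳ a)) a≤
private-sum-large a 0 (suc _) a≤ b≤ c≤ b→a c→a = ≤-trans (+-mono-≤ (c→a (s≤s z≤n)) c≤) (m≤m+n 11 11)
private-sum-large a (suc _) c a≤ b≤ c≤ b→a c→a = ≤-trans (+-mono-≤ (b→a (s≤s z≤n)) (+-mono-≤ b≤ c≤)) (m≤m+n 12 10)

-- Three terms of at most 7 sum to at most 21; a term of at least 8 leaves at most 1 for each of the
-- others.
private-sum : ∀ a b c → a ≤ 22 → b ≤ 22 → c ≤ 22 →
  (8 ≤ a → b ≤ 1) → (8 ≤ a → c ≤ 1) → (8 ≤ b → a ≤ 1) →
  (8 ≤ b → c ≤ 1) → (8 ≤ c → a ≤ 1) → (8 ≤ c → b ≤ 1) →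
  (1 ≤ b → a ≤ 10) → (1 ≤ c → a ≤ 10) → (1 ≤ a → b ≤ 10) →
  (1 ≤ c → b ≤ 10) → (1 ≤ a → c ≤ 10) → (1 ≤ b → c ≤ 10) →
  a + (b + c) ≤ 22
private-sum a b c a≤ b≤ c≤ ab ac ba bc ca cb b→a c→a a→b c→b a→c b→c with 8 ≤? a | 8 ≤? b | 8 ≤? c
... | yes 8≤a | _ | _ = private-sum-large a b c a≤ (ab 8≤a) (ac 8≤a) b→a c→a
... | no _ | yes 8≤b | _ = subst (_≤ 22) (solve 3 (λ a b c → b :+ (a :+ c) := a :+ (b :+ c)) refl a b c)
    (private-sum-large b a c b≤ (ba 8≤b) (bc 8≤b) a→b c→b)
  where open +-*-Solver
... | no _ | no _ | yes 8≤c = subst (_≤ 22) (solve 3 (λ a b c → c :+ (a :+ b) := a :+ (b :+ c)) refl a b c)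
    (private-sum-large c a b c≤ (ca 8≤c) (cb 8≤c) a→c b→c)
  where open +-*-Solver
... | no a<8 | no b<8 | no c<8 = ≤-trans (+-mono-≤ (small a<8) (+-mono-≤ (small b<8) (small c<8))) (m≤m+n 21 1)
  where
  small : ∀ {n} → ¬ (8 ≤ n) → n ≤ 7
  small 8≰n = ≤-pred (≰⇒> 8≰n)

module TripleSystem {X V : Set} (_≟ˣ_ : DecidableEquality X) (_≟_ : DecidableEquality V)
                    (els : X → List V) where

  open Hypergraph _≟ˣ_ _≟_ els
  open import Data.List.Membership.DecPropositional _≟_ using (_∈?_)
  open import Data.List.Membership.DecPropositional _≟ˣ_ using () renaming (_∈?_ to _∈ˣ?_)

  MeetIn : List V → X → X → Set
  MeetIn C A B = ∀ v → (v ∈ els A → v ∈ els B → v ∈ C) × (v ∈ C → v ∈ els A × v ∈ els B)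

  linkEls : V → X → List V
  linkEls v e = filter (λ x → ¬? (x ≟ v)) (els e)

  ∈-link⁺ : ∀ {v x e} → x ∈ els e → x ≢ v → x ∈ linkEls v e
  ∈-link⁺ = ∈-filter⁺ _

  ∈-link⁻ : ∀ {v x} e → x ∈ linkEls v e → x ∈ els e × x ≢ v
  ∈-link⁻ e = ∈-filter⁻ _ {xs = els e}

  module Link (v : V) where
    open Hypergraph _≟ˣ_ _≟_ (linkEls v) public
    open Graph _≟ˣ_ _≟_ (linkEls v) public

  -- Degree, link and matching bounds from sunflowers with at most two core points

  module SunflowerBound {F : List X} (U : Uniform 3 F)
    (free : ∀ C L → All (_∈ F) L → Unique L → AllPairs (MeetIn C) L → length L ≤ 5) where
    open Uniform U
    open ≤-Reasoning

    -- A further point of `A` would be a fourth point of a triple.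
    three-determine : ∀ {A B a b c} → A ∈ F → B ∈ F → a ≢ b → a ≢ c → b ≢ c →
      a ∈ els A → b ∈ els A → c ∈ els A → a ∈ els B → b ∈ els B → c ∈ els B → A ≡ B
    three-determine {A} {B} {a} {b} {c} A∈F B∈F a≢b a≢c b≢c a∈A b∈A c∈A a∈B b∈B c∈B = ext A∈F B∈F A⊆B
      where
      abc = a ∷ b ∷ c ∷ []
      abc⊆A : ∀ {z} → z ∈ abc → z ∈ els A
      abc⊆A (here refl)                 = a∈A
      abc⊆A (there (here refl))         = b∈A
      abc⊆A (there (there (here refl))) = c∈A
      abc⊆B : ∀ {z} → z ∈ abc → z ∈ els B
      abc⊆B (here refl)                 = a∈B
      abc⊆B (there (here refl))         = b∈B
      abc⊆B (there (there (here refl))) = c∈B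
      A⊆B : ∀ {z} → z ∈ els A → z ∈ els B
      A⊆B {z} z∈A with z ∈? abc
      ... | yes z∈abc = abc⊆B z∈abc
      ... | no  z∉abc = contradiction
        (subst (4 ≤_) (size A∈F) (⊆⇒length≤
          (All.tabulate (λ y∈ z≡y → z∉abc (subst (_∈ abc) (sym z≡y) y∈)) ∷
            (a≢b ∷ a≢c ∷ []) ∷ (b≢c ∷ []) ∷ [] ∷ [])
          λ { (here refl) → z∈A ; (there y∈) → abc⊆A y∈ }))
        1+n≰n

    -- Distinct triples through `u` and `v` have different third points, so they form a sunflower
    -- with core `u`, `v`.
    pair-degree≤5 : ∀ {u v} L → u ≢ v → All (_∈ F) L → Unique L →
      (∀ {e} → e ∈ L → u ∈ els e) → (∀ {e} → e ∈ L → v ∈ els e) → length L ≤ 5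
    pair-degree≤5 {u} {v} L u≢v L⊆F L! u∈ v∈ = free (u ∷ v ∷ []) L L⊆F L! (unique⇒AllPairs L! meet)
      where
      meet : ∀ {A B} → A ∈ L → B ∈ L → A ≢ B → MeetIn (u ∷ v ∷ []) A B
      meet {A} {B} A∈L B∈L A≢B x = into , λ { (here refl) → u∈ A∈L , u∈ B∈L ; (there (here refl)) → v∈ A∈L , v∈ B∈L }
        where
        into : x ∈ els A → x ∈ els B → x ∈ u ∷ v ∷ []
        into x∈A x∈B with x ≟ u | x ≟ v
        ... | yes x≡u | _       = here x≡u
        ... | no _    | yes x≡v = there (here x≡v)
        ... | no x≢u  | no x≢v  = contradiction
          (three-determine (All.lookup L⊆F A∈L) (All.lookup L⊆F B∈L) u≢v (≢-sym x≢u) (≢-sym x≢v)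
            (u∈ A∈L) (v∈ A∈L) x∈A (u∈ B∈L) (v∈ B∈L) x∈B) A≢B

    link-uniform : ∀ {v E} → All (_∈ F) E → Unique E → (∀ {e} → e ∈ E → v ∈ els e) → Link.Uniform v 2 E
    link-uniform {v} E⊆F E! v∈ = record
      { distinct = E!
      ; simple   = λ e∈E → Uniqueₚ.filter⁺ _ (simple (All.lookup E⊆F e∈E))
      ; size     = λ e∈E → ℕ-suc-injective (trans
                     (length-filter-≢ _≟_ (simple (All.lookup E⊆F e∈E)) (v∈ e∈E)) (size (All.lookup E⊆F e∈E)))
      ; ext      = λ {e} {f} e∈E f∈E e⊆f → ext (All.lookup E⊆F e∈E) (All.lookup E⊆F f∈E) λ {x} x∈e →
                     [ (λ { refl → v∈ f∈E }) , (λ x≢v → proj₁ (∈-link⁻ f (e⊆f (∈-link⁺ {e = e} x∈e x≢v)))) ]′ (toSum (x ≟ v))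
      }

    -- A matching in the link of `v` is a sunflower with core `v`.
    link-matching≤5 : ∀ {v} N → All (_∈ F) N → (∀ {e} → e ∈ N → v ∈ els e) →
      Unique N → Link.Matching v N → length N ≤ 5
    link-matching≤5 {v} N N⊆F v∈ N! N-matching = free (v ∷ []) N N⊆F N! (unique⇒AllPairs N! meet)
      where
      meet : ∀ {A B} → A ∈ N → B ∈ N → A ≢ B → MeetIn (v ∷ []) A B
      meet {A} {B} A∈N B∈N A≢B x = into , λ { (here refl) → v∈ A∈N , v∈ B∈N }
        where
        into : x ∈ els A → x ∈ els B → x ∈ v ∷ []
        into x∈A x∈B with x ≟ v
        ... | yes x≡v = here x≡v
        ... | no  x≢v = contradiction
          (Link.shared⇒≡ v N-matching A∈N B∈N (∈-link⁺ {e = A} x∈A x≢v) (∈-link⁺ {e = B} x∈B x≢v)) A≢B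

    -- Applied with `t = 5` to all edges at `v`, giving 27, and with `t = 4` to the private ones,
    -- giving 22.
    link-bound : ∀ v t E → All (_∈ F) E → Unique E → (∀ {e} → e ∈ E → v ∈ els e) →
      (∀ N → All (_∈ E) N → Link.Matching v N → length N ≤ t) → length E ≤ edgeBound t
    link-bound v t E E⊆F E! v∈ bound =
      Link.edges≤edgeBound v t t ≤-refl (link-uniform E⊆F E! v∈) link-degree bound
      where
      link-degree : ∀ u → Link.degree v u E ≤ 5
      link-degree u with u ≟ v
      ... | yes refl = ≤-trans (⊆⇒length≤ {ys = []} (Uniqueₚ.filter⁺ _ E!)
            (λ {e} e∈ → contradiction refl (proj₂ (∈-link⁻ e (proj₂ (∈-filter⁻ (λ e → u ∈? linkEls v e) {xs = E} e∈)))))) z≤n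
      ... | no u≢v = pair-degree≤5 (filter (λ e → u ∈? linkEls v e) E) u≢v
            (filter⊆ _ E⊆F)
            (Uniqueₚ.filter⁺ _ E!)
            (λ {e} e∈ → proj₁ (∈-link⁻ e (proj₂ (∈-filter⁻ (λ e → u ∈? linkEls v e) {xs = E} e∈))))
            (λ e∈ → v∈ (proj₁ (∈-filter⁻ (λ e → u ∈? linkEls v e) {xs = E} e∈)))

    degree≤27 : ∀ v → degree v F ≤ 27
    degree≤27 v = link-bound v 5 (filter ∋v? F) (filter⊆ ∋v? (All.tabulate id)) (Uniqueₚ.filter⁺ ∋v? distinct) v∈
      λ N N⊆ N! → link-matching≤5 N (All.map (proj₁ ∘ ∈-filter⁻ ∋v?) N⊆) (λ e∈ → v∈ (All.lookup N⊆ e∈))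
        (Link.matching-distinct v
          (link-uniform (filter⊆ ∋v? (All.tabulate id)) (Uniqueₚ.filter⁺ ∋v? distinct) v∈) N⊆ N!) N!
      where
      ∋v? = λ e → v ∈? els e
      v∈ : ∀ {e} → e ∈ filter ∋v? F → v ∈ els e
      v∈ e∈ = proj₂ (∈-filter⁻ ∋v? {xs = F} e∈)

    -- A matching is a sunflower with empty core.
    matching≤5 : ∀ M → All (_∈ F) M → Matching M → length M ≤ 5
    matching≤5 M M⊆F M! = free [] M M⊆F (matching-distinct U M⊆F M!)
      (AllPairs.map (λ A#B x → (λ x∈A x∈B → ⊥-elim (A#B x x∈A x∈B)) , λ ()) M!)

    -- Private edges of a maximum matching

    module Private {M : List X} (M⊆F : All (_∈ F) M) (M! : Matching M)
      (M-max : ∀ N → All (_∈ F) N → Matching N → length N ≤ length M) where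

      W : List V
      W = V[ M ]

      PrivateTo : V → X → Set
      PrivateTo v e = v ∈ els e × All (λ u → u ∈ els e → u ≡ v) W

      privateTo? : ∀ v e → Dec (PrivateTo v e)
      privateTo? v e = v ∈? els e ×-dec All.all? (λ u → u ∈? els e →-dec u ≟ v) W

      G : V → List X
      G v = filter (privateTo? v) F

      G⊆F : ∀ v → All (_∈ F) (G v)
      G⊆F v = filter⊆ (privateTo? v) (All.tabulate id)

      G! : ∀ v → Unique (G v)
      G! v = Uniqueₚ.filter⁺ (privateTo? v) distinct

      ∈G⇒private : ∀ {v e} → e ∈ G v → PrivateTo v e
      ∈G⇒private {v} e∈ = proj₂ (∈-filter⁻ (privateTo? v) {xs = F} e∈)

      ∈G⇒∋ : ∀ {v e} → e ∈ G v → v ∈ els e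
      ∈G⇒∋ = proj₁ ∘ ∈G⇒private

      ∈G⇒≡ : ∀ {v e u} → e ∈ G v → u ∈ W → u ∈ els e → u ≡ v
      ∈G⇒≡ e∈ u∈W = All.lookup (proj₂ (∈G⇒private e∈)) u∈W

      -- Private edges at `v` meet `A` in `v` only, so `A` extends their matchings in the link of
      -- `v`, which thus have at most 4 edges.
      private≤22 : ∀ {A v} → A ∈ M → v ∈ els A → length (G v) ≤ 22
      private≤22 {A} {v} A∈M v∈A = link-bound v 4 (G v) (G⊆F v) (G! v) ∈G⇒∋ λ N N⊆G N! →
        ≤-pred (link-matching≤5 (A ∷ N) (All.lookup M⊆F A∈M ∷ All.map (proj₁ ∘ ∈-filter⁻ (privateTo? v)) N⊆G)
          (λ { (here refl) → v∈A ; (there e∈) → ∈G⇒∋ (All.lookup N⊆G e∈) })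
          (All.tabulate (λ e∈ → λ { refl → A∉G (All.lookup N⊆G e∈) }) ∷
            Link.matching-distinct v (link-uniform (G⊆F v) (G! v) ∈G⇒∋) N⊆G N!)
          (All.map A#G N⊆G ∷ N!))
        where
        A#G : ∀ {e} → e ∈ G v → Link.DisjointEdges v A e
        A#G {e} e∈ x x∈A x∈e = proj₂ (∈-link⁻ A x∈A)
          (∈G⇒≡ e∈ (covered⁺ A∈M (proj₁ (∈-link⁻ A x∈A))) (proj₁ (∈-link⁻ e x∈e)))
        A∉G : A ∉ G v
        A∉G A∈G with nonempty⇒∃ (≤-trans (s≤s z≤n) (≤-reflexive
          (sym (Link.Uniform.size {v = v} (link-uniform (All.lookup M⊆F A∈M ∷ []) ([] ∷ []) λ { (here refl) → v∈A }) (here refl)))))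
        ... | x , x∈ = A#G A∈G x x∈ x∈

      -- If e and f were disjoint, they could replace A in the maximum matching M.
      cross-intersecting : ∀ {A v w e f} → A ∈ M → v ∈ els A → w ∈ els A → v ≢ w →
        e ∈ G v → f ∈ G w → ∃[ x ] x ∈ els e × x ∈ els f × x ∉ W
      cross-intersecting {A} {v} {w} {e} {f} A∈M v∈A w∈A v≢w e∈ f∈ with any? (_∈? els f) (els e)
      -- In `W`, `e` has only the point `v` and `f` only `w`, so a common point lies off `W`.
      ... | yes p = let x , x∈e , x∈f = find p in
        x , x∈e , x∈f , λ x∈W → v≢w (trans (sym (∈G⇒≡ e∈ x∈W x∈e)) (∈G⇒≡ f∈ x∈W x∈f))
      ... | no e#f = contradiction
        (≤-trans (s≤s (⊆⇒length≤ (matching-distinct U M⊆F M!) M⊆A∷M⁻))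
          (M-max (e ∷ f ∷ M⁻)
            (All.lookup (G⊆F v) e∈ ∷ All.lookup (G⊆F w) f∈ ∷ filter⊆ ≢A? M⊆F)
            (((λ x x∈e x∈f → e#f (lose x∈e x∈f)) ∷ All.tabulate (G#M⁻ v∈A e∈)) ∷
              All.tabulate (G#M⁻ w∈A f∈) ∷ AllPairsₚ.filter⁺ ≢A? M!)))
        1+n≰n
        where
        ≢A? = λ B → ¬? (B ≟ˣ A)
        M⁻ = filter ≢A? M
        M⊆A∷M⁻ : ∀ {B} → B ∈ M → B ∈ A ∷ M⁻
        M⊆A∷M⁻ {B} B∈M = [ here , there ∘ ∈-filter⁺ ≢A? B∈M ]′ (toSum (B ≟ˣ A))
        G#M⁻ : ∀ {u g B} → u ∈ els A → g ∈ G u → B ∈ M⁻ → DisjointEdges g B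
        G#M⁻ u∈A g∈ B∈M⁻ x x∈g x∈B with ∈-filter⁻ ≢A? {xs = M} B∈M⁻
        ... | B∈M , B≢A with ∈G⇒≡ g∈ (covered⁺ B∈M x∈B) x∈g
        ... | refl = B≢A (shared⇒≡ M! B∈M A∈M x∈B u∈A)

      record Ends (w : V) (f : X) : Set where
        field
          {x y} : V
          x∈f   : x ∈ els f
          y∈f   : y ∈ els f
          x∉W   : x ∉ W
          y∉W   : y ∉ W
          x≢y   : x ≢ y
          ends  : ∀ {z} → z ∈ els f → z ∉ W → z ≡ x ⊎ z ≡ y

      private-ends : ∀ {w f} → w ∈ W → f ∈ G w → Ends w f
      private-ends {w} {f} w∈W f∈ = go (linkEls w f) refl (Link.Uniform.size L f∈) (Link.Uniform.simple L f∈)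
        where
        L : Link.Uniform w 2 (G w)
        L = link-uniform (G⊆F w) (G! w) ∈G⇒∋
        off-W : ∀ {z} → z ∈ linkEls w f → z ∉ W
        off-W z∈ z∈W = proj₂ (∈-link⁻ f z∈) (∈G⇒≡ f∈ z∈W (proj₁ (∈-link⁻ f z∈)))
        go : ∀ xs → linkEls w f ≡ xs → length xs ≡ 2 → Unique xs → Ends w f
        go (x ∷ y ∷ []) eq refl ((x≢y ∷ _) ∷ _) = record
          { x∈f = proj₁ (∈-link⁻ f x∈) ; y∈f = proj₁ (∈-link⁻ f y∈)
          ; x∉W = off-W x∈ ; y∉W = off-W y∈ ; x≢y = x≢y
          ; ends = λ z∈f z∉W → pick (subst (_ ∈_) eq (∈-link⁺ {e = f} z∈f λ { refl → z∉W w∈W })) }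
          where
          x∈ = subst (x ∈_) (sym eq) (here refl)
          y∈ = subst (y ∈_) (sym eq) (there (here refl))
          pick : ∀ {z} → z ∈ x ∷ y ∷ [] → z ≡ x ⊎ z ≡ y
          pick (here p)         = inj₁ p
          pick (there (here p)) = inj₂ p

      module _ {A v w} (A∈M : A ∈ M) (v∈A : v ∈ els A) (w∈A : w ∈ els A) (v≢w : v ≢ w) where

        private
          v∈W = covered⁺ A∈M v∈A
          w∈W = covered⁺ A∈M w∈A

          ∉W⇒≢ : ∀ {x u} → u ∈ W → x ∉ W → u ≢ x
          ∉W⇒≢ u∈W x∉W refl = x∉W u∈W

          meets-end : ∀ {f e} → f ∈ G w → (D : Ends w f) → e ∈ G v → Ends.x D ∈ els e ⊎ Ends.y D ∈ els e
          meets-end f∈ D e∈ with cross-intersecting A∈M v∈A w∈A v≢w e∈ f∈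
          ... | z , z∈e , z∈f , z∉W with Ends.ends D z∈f z∉W
          ... | inj₁ refl = inj₁ z∈e
          ... | inj₂ refl = inj₂ z∈e

          degree≤5 : ∀ {x} → x ∉ W → degree x (G v) ≤ 5
          degree≤5 {x} x∉W = pair-degree≤5 (filter ∋x? (G v)) (∉W⇒≢ v∈W x∉W)
            (filter⊆ ∋x? (G⊆F v)) (Uniqueₚ.filter⁺ ∋x? (G! v))
            (∈G⇒∋ ∘ proj₁ ∘ ∈-filter⁻ ∋x?) (proj₂ ∘ ∈-filter⁻ ∋x? {xs = G v})
            where ∋x? = λ e → x ∈? els e

          length-G≤ : ∀ {f} → f ∈ G w → (D : Ends w f) →
            length (G v) ≤ degree (Ends.x D) (G v) + degree (Ends.y D) (G v)
          length-G≤ f∈ D = count-⊎ _ _ (G v) (meets-end f∈ D)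

        -- Each edge of `G v` contains one of the two ends of a fixed `f` in `G w`, and at most 5
        -- triples contain `v` and a given end.
        private≤10 : 1 ≤ length (G w) → length (G v) ≤ 10
        private≤10 1≤ with nonempty⇒∃ 1≤
        ... | f , f∈ = ≤-trans (length-G≤ f∈ D) (+-mono-≤ (degree≤5 x∉W) (degree≤5 y∉W))
          where
          D = private-ends w∈W f∈
          open Ends D

        private
          -- An edge of G v through x ∉ f′ also contains one of the two ends of f′.
          through≤2 : ∀ {f′ x} → f′ ∈ G w → x ∉ W → x ∉ els f′ → degree x (G v) ≤ 2
          through≤2 {f′} {x} f′∈ x∉W x∉f′ = ≤-trans
            (count-⊎ _ _ L (meets-end f′∈ D ∘ proj₁ ∘ ∈-filter⁻ ∋x?))
            (+-mono-≤ (one D.x∉W D.x∈f) (one D.y∉W D.y∈f))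
            where
            D = private-ends w∈W f′∈
            module D = Ends D
            ∋x? = λ e → x ∈? els e
            L = filter ∋x? (G v)
            one : ∀ {z} → z ∉ W → z ∈ els f′ → degree z L ≤ 1
            one {z} z∉W z∈f′ = all-equal⇒length≤1 (Uniqueₚ.filter⁺ _ (Uniqueₚ.filter⁺ ∋x? (G! v))) same
              where
              ∋z? = λ e → z ∈? els e
              same : ∀ {e g} → e ∈ filter ∋z? L → g ∈ filter ∋z? L → e ≡ g
              same e∈ g∈ with ∈-filter⁻ ∋z? {xs = L} e∈ | ∈-filter⁻ ∋z? {xs = L} g∈
              ... | e∈L , z∈e | g∈L , z∈g with ∈-filter⁻ ∋x? {xs = G v} e∈L | ∈-filter⁻ ∋x? {xs = G v} g∈L
              ... | e∈G , x∈e | g∈G , x∈g = three-determine (All.lookup (G⊆F v) e∈G) (All.lookup (G⊆F v) g∈G)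
                (∉W⇒≢ v∈W x∉W) (∉W⇒≢ v∈W z∉W) (λ { refl → x∉f′ z∈f′ })
                (∈G⇒∋ e∈G) x∈e z∈e (∈G⇒∋ g∈G) x∈g z∈g

        -- If `f′` omitted an end of `f`, at most 2 edges of `G v` would contain that end and at
        -- most 5 the other, 7 in all. So `f′` contains both ends and `w`, and equals `f`.
        private≤1 : 8 ≤ length (G v) → length (G w) ≤ 1
        private≤1 8≤ = all-equal⇒length≤1 (G! w) same
          where
          same : ∀ {f f′} → f ∈ G w → f′ ∈ G w → f ≡ f′
          same {f} {f′} f∈ f′∈ = three-determine (All.lookup (G⊆F w) f∈) (All.lookup (G⊆F w) f′∈)
            (∉W⇒≢ w∈W x∉W) (∉W⇒≢ w∈W y∉W) x≢y
            (∈G⇒∋ f∈) x∈f y∈f (∈G⇒∋ f′∈)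
            (decidable-stable (x ∈? els f′) λ x∉f′ →
              1+n≰n (≤-trans 8≤ (≤-trans (length-G≤ f∈ D) (+-mono-≤ (through≤2 f′∈ x∉W x∉f′) (degree≤5 y∉W)))))
            (decidable-stable (y ∈? els f′) λ y∉f′ →
              1+n≰n (≤-trans 8≤ (≤-trans (length-G≤ f∈ D) (+-mono-≤ (degree≤5 x∉W) (through≤2 f′∈ y∉W y∉f′)))))
            where
            D = private-ends w∈W f∈
            open Ends D

      edge-sum≤103 : ∀ {A} → A ∈ M → ∑ (els A) (λ v → degree v F + length (G v)) ≤ 103
      edge-sum≤103 {A} A∈M = begin
        ∑ (els A) (λ v → degree v F + length (G v))              ≡⟨ ∑-+ (els A) ⟩
        ∑ (els A) (λ v → degree v F) + ∑ (els A) (length ∘ G)    ≤⟨ +-mono-≤ degrees (privates (els A) id (size A∈F) (simple A∈F)) ⟩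
        81 + 22                                                  ∎
        where
        A∈F = All.lookup M⊆F A∈M
        degrees : ∑ (els A) (λ v → degree v F) ≤ 81
        degrees = begin
          ∑ (els A) (λ v → degree v F)  ≤⟨ ∑-mono (els A) (λ {v} _ → degree≤27 v) ⟩
          ∑ (els A) (λ _ → 27)          ≡⟨ ∑-const (els A) 27 ⟩
          length (els A) * 27           ≡⟨ cong (_* 27) {y = 3} (size A∈F) ⟩
          81                            ∎
        privates : ∀ vs → (∀ {v} → v ∈ vs → v ∈ els A) → length vs ≡ 3 → Unique vs → ∑ vs (length ∘ G) ≤ 22
        privates (a ∷ b ∷ c ∷ []) ∈A refl ((a≢b ∷ a≢c ∷ _) ∷ (b≢c ∷ _) ∷ _) =
          subst (λ s → length (G a) + (length (G b) + s) ≤ 22) (sym (+-identityʳ (length (G c))))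
          (private-sum (length (G a)) (length (G b)) (length (G c))
            (private≤22 A∈M a∈) (private≤22 A∈M b∈) (private≤22 A∈M c∈)
            (private≤1 A∈M a∈ b∈ a≢b) (private≤1 A∈M a∈ c∈ a≢c) (private≤1 A∈M b∈ a∈ (≢-sym a≢b))
            (private≤1 A∈M b∈ c∈ b≢c) (private≤1 A∈M c∈ a∈ (≢-sym a≢c)) (private≤1 A∈M c∈ b∈ (≢-sym b≢c))
            (private≤10 A∈M a∈ b∈ a≢b) (private≤10 A∈M a∈ c∈ a≢c) (private≤10 A∈M b∈ a∈ (≢-sym a≢b))
            (private≤10 A∈M b∈ c∈ b≢c) (private≤10 A∈M c∈ a∈ (≢-sym a≢c)) (private≤10 A∈M c∈ b∈ (≢-sym b≢c)))
          where
          a∈ = ∈A (here refl)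
          b∈ = ∈A (there (here refl))
          c∈ = ∈A (there (there (here refl)))

      edge-weight : ∀ {e} → e ∈ F →
        2 + indicator (e ∈ˣ? M) ≤ count (_∈? els e) W + count (λ v → privateTo? v e) W
      edge-weight {e} e∈F with e ∈ˣ? M
      ... | yes e∈M = ≤-trans
        (subst (_≤ count (_∈? els e) W) (size e∈F)
          (⊆⇒length≤ (simple e∈F) λ v∈e → ∈-filter⁺ (_∈? els e) (covered⁺ e∈M v∈e) v∈e))
        (m≤m+n _ _)
      ... | no e∉M with filter (_∈? els e) W in eq
      -- An edge that avoids `W` would enlarge `M`.
      ... | [] = contradiction
        (M-max (e ∷ M) (e∈F ∷ M⊆F) (matching-∷ M! λ v∈e v∈W →
          ¬Any[] (subst (_ ∈_) eq (∈-filter⁺ (_∈? els e) v∈W v∈e))))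
        1+n≰n
      -- The single point of `W` in `e` makes `e` private, which supplies the second unit.
      ... | v ∷ [] = s≤s (∃⇒nonempty (∈-filter⁺ (λ v → privateTo? v e) (proj₁ v∈) (proj₂ v∈ , All.tabulate only)))
        where
        v∈ : v ∈ W × v ∈ els e
        v∈ = ∈-filter⁻ (_∈? els e) {xs = W} (subst (v ∈_) (sym eq) (here refl))
        only : ∀ {u} → u ∈ W → u ∈ els e → u ≡ v
        only u∈W u∈e with subst (_ ∈_) eq (∈-filter⁺ (_∈? els e) u∈W u∈e)
        ... | here u≡v = u≡v
      ... | _ ∷ _ ∷ _ = s≤s (s≤s z≤n)

      M∩F : length M ≤ ∑ F (λ e → indicator (e ∈ˣ? M))
      M∩F = subst (length M ≤_) (count≡∑ (_∈ˣ? M) F)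
        (⊆⇒length≤ (matching-distinct U M⊆F M!) λ e∈M → ∈-filter⁺ (_∈ˣ? M) (All.lookup M⊆F e∈M) e∈M)

      -- Sums `edge-weight` over `F`, exchanges the sums, and groups the points of `W` by the edges
      -- of `M`.
      weighted-count : length F * 2 + length M ≤ length M * 103
      weighted-count = begin
        length F * 2 + length M                                   ≤⟨ +-mono-≤ (≤-reflexive (sym (∑-const F 2))) M∩F ⟩
        ∑ F (λ _ → 2) + ∑ F (λ e → indicator (e ∈ˣ? M))           ≡⟨ ∑-+ F ⟨
        ∑ F (λ e → 2 + indicator (e ∈ˣ? M))                       ≤⟨ ∑-mono F edge-weight ⟩
        ∑ F (λ e → count (_∈? els e) W + count (λ v → privateTo? v e) W)  ≡⟨ ∑-+ F ⟩
        ∑ F (λ e → count (_∈? els e) W) + ∑ F (λ e → count (λ v → privateTo? v e) W)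
          ≡⟨ cong₂ _+_ (∑-degree F W) (double-count (λ e v → privateTo? v e) F W) ⟩
        ∑ W (λ v → degree v F) + ∑ W (length ∘ G)                 ≡⟨ ∑-+ W ⟨
        ∑ W (λ v → degree v F + length (G v))                     ≡⟨ ∑-concatMap M els ⟩
        ∑ M (λ A → ∑ (els A) (λ v → degree v F + length (G v)))   ≤⟨ ∑-mono M edge-sum≤103 ⟩
        ∑ M (λ _ → 103)                                           ≡⟨ ∑-const M 103 ⟩
        length M * 103                                            ∎

    size≤255 : length F ≤ 255
    size≤255 with maximum-list matching? [] F 5 matching≤5
    ... | M , M⊆F , M! , M≤5 , M-max = *-cancelʳ-≤ (length F) 255 2 (begin
      -- Cancelling `length M` turns 103 into 102, and 5 · 102 = 2 · 255.
      length F * 2      ≤⟨ +-cancelʳ-≤ (length M) (length F * 2) (length M * 102) (begin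
        length F * 2 + length M   ≤⟨ weighted-count ⟩
        length M * 103            ≡⟨ solve 1 (λ m → m :* con 103 := m :* con 102 :+ m) refl (length M) ⟩
        length M * 102 + length M ∎) ⟩
      length M * 102    ≤⟨ *-monoˡ-≤ 102 M≤5 ⟩
      510               ∎)
      where
      open Private M⊆F M! M-max
      open +-*-Solver

-- Families of subsets

_≟ˢ_ : ∀ {n} → DecidableEquality (Subset n)
_≟ˢ_ = Vecₚ.≡-dec Bool._≟_

elements : ∀ {n} → Subset n → List (Fin n)
elements []            = []
elements (inside  ∷ p) = zero ∷ map suc (elements p)
elements (outside ∷ p) = map suc (elements p)

length-elements : ∀ {n} (p : Subset n) → length (elements p) ≡ ∣ p ∣
length-elements []            = refl
length-elements (inside  ∷ p) = cong suc (trans (length-map suc (elements p)) (length-elements p))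
length-elements (outside ∷ p) = trans (length-map suc (elements p)) (length-elements p)

elements-unique : ∀ {n} (p : Subset n) → Unique (elements p)
elements-unique []            = []
elements-unique (inside  ∷ p) =
  Allₚ.map⁺ (All.universal (λ _ ()) (elements p)) ∷ Uniqueₚ.map⁺ suc-injective (elements-unique p)
elements-unique (outside ∷ p) = Uniqueₚ.map⁺ suc-injective (elements-unique p)

∈-elements⁺ : ∀ {n} {p : Subset n} {x} → x ∈ˢ p → x ∈ elements p
∈-elements⁺ {p = inside  ∷ p} Vec.here = here refl
∈-elements⁺ {p = inside  ∷ p} (Vec.there x∈p) = there (∈-map⁺ suc (∈-elements⁺ x∈p))
∈-elements⁺ {p = outside ∷ p} (Vec.there x∈p) = ∈-map⁺ suc (∈-elements⁺ x∈p)

∈-elements⁻ : ∀ {n} {p : Subset n} {x} → x ∈ elements p → x ∈ˢ p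
∈-elements⁻ {p = inside  ∷ p} (here refl) = Vec.here
∈-elements⁻ {p = inside  ∷ p} (there x∈) with ∈-map⁻ suc x∈
... | _ , y∈ , refl = Vec.there (∈-elements⁻ y∈)
∈-elements⁻ {p = outside ∷ p} x∈ with ∈-map⁻ suc x∈
... | _ , y∈ , refl = Vec.there (∈-elements⁻ y∈)

⊆∧∣∣≤⇒≡ : ∀ {n} {p q : Subset n} → p ⊆ q → ∣ q ∣ ≤ ∣ p ∣ → p ≡ q
⊆∧∣∣≤⇒≡ {p = p} {q} p⊆q ∣q∣≤∣p∣ = ⊆-antisym p⊆q λ {x} x∈q → decidable-stable (x ∈ˢ? p) λ x∉p →
  1+n≰n (≤-trans
    (subst (λ s → suc s ≤ length (elements q)) (length-elements p)
      (⊆⇒length≤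
        (All.tabulate (λ y∈ x≡y → x∉p (subst (_∈ˢ p) (sym x≡y) (∈-elements⁻ y∈))) ∷ elements-unique p)
        λ { (here refl) → ∈-elements⁺ x∈q ; (there y∈) → ∈-elements⁺ (p⊆q (∈-elements⁻ y∈)) }))
    (subst (_≤ ∣ p ∣) (sym (length-elements q)) ∣q∣≤∣p∣))

-- Sunflowers as lists, and their decidability

lookup-injective : ∀ {A : Set} {xs : List A} → Unique xs → ∀ {i j} → lookup xs i ≡ lookup xs j → i ≡ j
lookup-injective (x∉ ∷ xs!) {zero}  {zero}  eq = refl
lookup-injective (x∉ ∷ xs!) {zero}  {suc j} eq = contradiction eq (All.lookup x∉ (∈-lookup j))
lookup-injective (x∉ ∷ xs!) {suc i} {zero}  eq = contradiction (sym eq) (All.lookup x∉ (∈-lookup i))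
lookup-injective (x∉ ∷ xs!) {suc i} {suc j} eq = cong suc (lookup-injective xs! eq)

SunflowerIn : ∀ {n} → ℕ → List (Subset n) → Set
SunflowerIn k F = ∃[ L ] length L ≡ k × All (_∈ F) L × Unique L × ∃[ C ] AllPairs (λ A B → A ∩ B ≡ C) L

list⇒sunflower : ∀ {n k} {F : List (Subset n)} → SunflowerIn k F → ContainsSunflower k F
list⇒sunflower (L , refl , L⊆F , L! , C , LC) =
  lookup L ,
  (lookup-injective L! , C , λ i j i≢j →
    AllPairs-lookup {R = λ A B → A ∩ B ≡ C} (λ {A} {B} → trans (∩-comm B A)) LC (∈-lookup i) (∈-lookup j)
      (i≢j ∘ lookup-injective L!)) ,
  λ i → All.lookup L⊆F (∈-lookup i)

sunflower⇒list : ∀ {n k} {F : List (Subset n)} → ContainsSunflower k F → SunflowerIn k F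
sunflower⇒list (A , (A-inj , C , AC) , A∈F) =
  tabulate A , length-tabulate A , Allₚ.tabulate⁺ A∈F , Uniqueₚ.tabulate⁺ A-inj ,
  C , AllPairsₚ.tabulate⁺ (AC _ _)

containsSunflower? : ∀ {n} k (F : List (Subset n)) → Dec (ContainsSunflower k F)
containsSunflower? k F = map′ list⇒sunflower sunflower⇒list
  (∃List? (λ L → UniqueDec.unique? _≟ˢ_ L ×-dec anySubset? (λ C → allPairs? (λ A B → (A ∩ B) ≟ˢ C) L)) F k)

sunflowerFree? : ∀ w k {n} (F : List (Subset n)) → Dec (SunflowerFree w k F)
sunflowerFree? w k F = map′
  (λ (d , u , s) → record { distinct = d ; uniform = u ; noSunflower = s })
  (λ S → let open SunflowerFree S in distinct , uniform , noSunflower)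
  (UniqueDec.unique? _≟ˢ_ F ×-dec (All.all? (λ A → ∣ A ∣ Data.Nat.≟ w) F ×-dec ¬? (containsSunflower? k F)))

module _ {n : ℕ} where
  open Hypergraph {X = Subset n} _≟ˢ_ _≟ᶠ_ elements public using (Uniform; V[_]; length-V; covered⁺)

uniform-subsets : ∀ {w n} {F : List (Subset n)} → Unique F → All (λ A → ∣ A ∣ ≡ w) F → Uniform w F
uniform-subsets F! ∣F∣≡w = record
  { distinct = F!
  ; simple   = λ {A} _ → elements-unique A
  ; size     = λ {A} A∈F → trans (length-elements A) (All.lookup ∣F∣≡w A∈F)
  ; ext      = λ A∈F B∈F A⊆B → ⊆∧∣∣≤⇒≡ (∈-elements⁻ ∘ A⊆B ∘ ∈-elements⁺)
                 (≤-reflexive (trans (All.lookup ∣F∣≡w B∈F) (sym (All.lookup ∣F∣≡w A∈F))))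
  }

sunflowerFree⇒≤255 : ∀ {n} (F : List (Subset n)) → SunflowerFree 3 6 F → length F ≤ 255
sunflowerFree⇒≤255 F S = SunflowerBound.size≤255 (uniform-subsets distinct uniform) free
  where
  open SunflowerFree S
  open TripleSystem _≟ˢ_ _≟ᶠ_ elements

  free : ∀ C L → All (_∈ F) L → Unique L → AllPairs (MeetIn C) L → length L ≤ 5
  free C L L⊆F L! LC = ≮⇒≥ λ 6≤L → noSunflower (list⇒sunflower
    ( take 6 L , trans (length-take 6 L) (m≤n⇒m⊓n≡m 6≤L) , Allₚ.take⁺ 6 L⊆F , Uniqueₚ.take⁺ 6 L!
    , common-core (take 6 L) (AllPairsₚ.take⁺ 6 LC) ))
    where
    same-core : ∀ {A B A′ B′} → MeetIn C A B → MeetIn C A′ B′ → A ∩ B ⊆ A′ ∩ B′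
    same-core {A} {B} AB A′B′ {x} x∈ =
      let x∈A , x∈B = x∈p∩q⁻ A B x∈
          x∈A′ , x∈B′ = proj₂ (A′B′ x) (proj₁ (AB x) (∈-elements⁺ x∈A) (∈-elements⁺ x∈B))
      in x∈p∩q⁺ (∈-elements⁻ x∈A′ , ∈-elements⁻ x∈B′)
    common-core : ∀ L → AllPairs (MeetIn C) L → ∃[ D ] AllPairs (λ A B → A ∩ B ≡ D) L
    -- With fewer than two sets any core will do, and the empty set is the default; otherwise the
    -- first intersection serves.
    common-core []          _ = Vec.replicate _ outside , []
    common-core (A ∷ [])    _ = Vec.replicate _ outside , [] ∷ []
    common-core (A ∷ B ∷ L) ABL@((AB ∷ _) ∷ _) =
      A ∩ B , AllPairs.map (λ A′B′ → ⊆-antisym (same-core A′B′ AB) (same-core AB A′B′)) ABL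

-- Bounding the size keeps the enumeration small: for `k = 2` and 26 points it has 1 + 26 + 325 =
-- 352 entries.
subsets≤ : (k n : ℕ) → List (Subset n)
subsets≤ k       zero    = [] ∷ []
subsets≤ zero    (suc n) = map (outside ∷_) (subsets≤ zero n)
subsets≤ (suc k) (suc n) = map (outside ∷_) (subsets≤ (suc k) n) ++ map (inside ∷_) (subsets≤ k n)

∈-subsets≤ : ∀ {k n} (p : Subset n) → ∣ p ∣ ≤ k → p ∈ subsets≤ k n
∈-subsets≤ []                        _       = here refl
∈-subsets≤ {zero}  (outside ∷ p) p≤k         = ∈-map⁺ (outside ∷_) (∈-subsets≤ p p≤k)
∈-subsets≤ {suc k} (outside ∷ p) p≤k         = ∈-++⁺ˡ (∈-map⁺ (outside ∷_) (∈-subsets≤ p p≤k))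
∈-subsets≤ {suc k} (inside  ∷ p) (s≤s p≤k)   = ∈-++⁺ʳ _ (∈-map⁺ (inside ∷_) (∈-subsets≤ p p≤k))

-- Restricts a family to the points that occur in it. A sunflower has at least two sets here, so its
-- core lies inside a member and survives the passage.
module Shrink {w k n} {F : List (Subset n)} (S : SunflowerFree w (2 + k) F) where
  open SunflowerFree S

  support : List (Fin n)
  support = filter (_∈ᶠ? V[ F ]) (allFin n)
    where open import Data.List.Membership.DecPropositional _≟ᶠ_ using () renaming (_∈?_ to _∈ᶠ?_)

  support-unique : Unique support
  support-unique = Uniqueₚ.filter⁺ _ (Uniqueₚ.allFin⁺ n)

  length-support : length support ≤ length F * w
  length-support = subst (length support ≤_)
    (length-V (uniform-subsets distinct uniform) (All.tabulate id))
    (⊆⇒length≤ support-unique (proj₂ ∘ ∈-filter⁻ _ {xs = allFin n}))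

  pull : Subset n → Subset (length support)
  pull A = Vec.tabulate (λ i → Vec.lookup A (lookup support i))

  ∈-pull⁺ : ∀ {A} {i} → lookup support i ∈ˢ A → i ∈ˢ pull A
  ∈-pull⁺ {A} {i} ∈A = Vecₚ.lookup⇒[]= i (pull A) (trans (Vecₚ.lookup∘tabulate _ i) (Vecₚ.[]=⇒lookup ∈A))

  ∈-pull⁻ : ∀ {A i} → i ∈ˢ pull A → lookup support i ∈ˢ A
  ∈-pull⁻ {A} {i} i∈ = Vecₚ.lookup⇒[]= _ A (trans (sym (Vecₚ.lookup∘tabulate _ i)) (Vecₚ.[]=⇒lookup i∈))

  Supported : Subset n → Set
  Supported A = ∀ {v} → v ∈ˢ A → v ∈ support

  supported : ∀ {A} → A ∈ F → Supported A
  supported A∈F v∈A = ∈-filter⁺ _ (∈-allFin _) (covered⁺ A∈F (∈-elements⁺ v∈A))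

  pull-⊆ : ∀ {A B} → Supported A → pull A ≡ pull B → A ⊆ B
  pull-⊆ {A} {B} sA eq {v} v∈A =
    subst (_∈ˢ B) (sym v≡) (∈-pull⁻ (subst (_ ∈ˢ_) eq (∈-pull⁺ (subst (_∈ˢ A) v≡ v∈A))))
    where
    v≡ : v ≡ lookup support (Any.index (sA v∈A))
    v≡ = lookup-index (sA v∈A)

  pull-injective : ∀ {A B} → Supported A → Supported B → pull A ≡ pull B → A ≡ B
  pull-injective sA sB eq = ⊆-antisym (pull-⊆ sA eq) (pull-⊆ sB (sym eq))

  pull-∩ : ∀ A B → pull (A ∩ B) ≡ pull A ∩ pull B
  pull-∩ A B = ⊆-antisym
    (λ i∈ → let ∈A , ∈B = x∈p∩q⁻ A B (∈-pull⁻ {A ∩ B} i∈) in x∈p∩q⁺ (∈-pull⁺ {A} ∈A , ∈-pull⁺ {B} ∈B))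
    (λ i∈ → let ∈A , ∈B = x∈p∩q⁻ (pull A) (pull B) i∈ in ∈-pull⁺ {A ∩ B} (x∈p∩q⁺ (∈-pull⁻ {A} ∈A , ∈-pull⁻ {B} ∈B)))

  ∣pull∣ : ∀ {A} → A ∈ F → ∣ pull A ∣ ≡ ∣ A ∣
  ∣pull∣ {A} A∈F = trans (sym (length-elements (pull A))) (trans (≤-antisym pull≤ ≤pull) (length-elements A))
    where
    image = map (lookup support) (elements (pull A))
    pull≤ : length (elements (pull A)) ≤ length (elements A)
    pull≤ = subst (_≤ length (elements A)) (length-map (lookup support) (elements (pull A)))
      (⊆⇒length≤ (Uniqueₚ.map⁺ (lookup-injective support-unique) (elements-unique (pull A)))
        λ v∈ → let i , i∈ , v≡ = ∈-map⁻ (lookup support) v∈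
               in subst (_∈ elements A) (sym v≡) (∈-elements⁺ (∈-pull⁻ {A} (∈-elements⁻ i∈))))
    ≤pull : length (elements A) ≤ length (elements (pull A))
    ≤pull = subst (length (elements A) ≤_) (length-map (lookup support) (elements (pull A)))
      (⊆⇒length≤ (elements-unique A) λ {v} v∈ →
        let v∈supp = supported A∈F (∈-elements⁻ v∈)
            v≡     = lookup-index v∈supp
        in subst (_∈ image) (sym v≡) (∈-map⁺ (lookup support) (∈-elements⁺ (∈-pull⁺ {A} (subst (_∈ˢ A) v≡ (∈-elements⁻ v∈))))))

  shrunk : SunflowerFree w (2 + k) (map pull F)
  shrunk = record
    { distinct = AllPairsₚ.map⁺ (unique⇒AllPairs distinct λ A∈F B∈F A≢B →
        A≢B ∘ pull-injective (supported A∈F) (supported B∈F))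
    ; uniform = Allₚ.map⁺ (All.tabulate λ A∈F → trans (∣pull∣ A∈F) (All.lookup uniform A∈F))
    ; noSunflower = noSunflower ∘ lift
    }
    where
    lift : ContainsSunflower (2 + k) (map pull F) → ContainsSunflower (2 + k) F
    -- `C′` lives on the smaller ground set; the intersection of the first two preimages, which
    -- `pull` sends to `C′`, is the core on the original one.
    lift (A′ , (A′-inj , C′ , A′C′) , A′∈) = A , (A-inj , A zero ∩ A (suc zero) , AC) , A∈F
      where
      A : Fin (2 + k) → Subset n
      A i = proj₁ (∈-map⁻ pull (A′∈ i))
      A∈F : ∀ i → A i ∈ F
      A∈F i = proj₁ (proj₂ (∈-map⁻ pull (A′∈ i)))
      A′≡ : ∀ i → A′ i ≡ pull (A i)
      A′≡ i = proj₂ (proj₂ (∈-map⁻ pull (A′∈ i)))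
      A-inj : ∀ {i j} → A i ≡ A j → i ≡ j
      A-inj {i} {j} eq = A′-inj (trans (A′≡ i) (trans (cong pull eq) (sym (A′≡ j))))
      pull-core : ∀ i j → i ≢ j → pull (A i ∩ A j) ≡ C′
      pull-core i j i≢j = trans (pull-∩ (A i) (A j)) (trans (sym (cong₂ _∩_ (A′≡ i) (A′≡ j))) (A′C′ i j i≢j))
      supported-∩ : ∀ i j → Supported (A i ∩ A j)
      supported-∩ i j x∈ = supported (A∈F i) (p∩q⊆p (A i) (A j) x∈)
      AC : ∀ i j → i ≢ j → A i ∩ A j ≡ A zero ∩ A (suc zero)
      AC i j i≢j = pull-injective (supported-∩ i j) (supported-∩ zero (suc zero))
        (trans (pull-core i j i≢j) (sym (pull-core zero (suc zero) λ ())))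

-- Existence of the maximum

Attained : ℕ → ℕ → ℕ → Set
Attained w k m = ∃[ n ] ∃[ F ] SunflowerFree w k {n} F × length F ≡ m

-- After shrinking, only ground sets of at most `m * w` points remain to be searched; `anyUpTo?`
-- takes a strict bound, hence `suc`.
attained? : ∀ w k → Decidable (Attained w (2 + k))
attained? w k m = map′ widen shrink
  (anyUpTo? (λ n → ∃List? (sunflowerFree? w (2 + k)) (subsets≤ w n) m) (suc (m * w)))
  where
  Small : Set
  Small = ∃[ n ] n < suc (m * w) × ∃[ F ] length F ≡ m × All (_∈ subsets≤ w n) F × SunflowerFree w (2 + k) F
  widen : Small → Attained w (2 + k) m
  widen (n , _ , F , l , _ , S) = n , F , S , l
  shrink : Attained w (2 + k) m → Small
  shrink (n , F , S , refl) =
    length support , s≤s length-support , map pull F , length-map pull F ,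
    All.map (λ {A} ∣A∣≡w → ∈-subsets≤ A (≤-reflexive ∣A∣≡w)) (SunflowerFree.uniform shrunk) , shrunk
    where open Shrink {k = k} S

greatest : {P : ℕ → Set} → Decidable P → ∀ b → (∀ m → P m → m ≤ b) → ∀ {m₀} → P m₀ →
           ∃[ m ] P m × (∀ m′ → P m′ → m′ ≤ m)
greatest P? b P≤b Pm₀ with P? b
... | yes Pb = b , Pb , P≤b
greatest {P} P? zero    P≤b {m₀} Pm₀ | no ¬Pb = contradiction (subst P (n≤0⇒n≡0 (P≤b m₀ Pm₀)) Pm₀) ¬Pb
greatest {P} P? (suc b) P≤b      Pm₀ | no ¬Pb =
  greatest P? b (λ m Pm → ≤-pred (≤∧≢⇒< (P≤b m Pm) λ m≡ → ¬Pb (subst P m≡ Pm))) Pm₀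

-- A family of 153 triples

triple : ∀ {n} → ℕ × ℕ × ℕ → Subset n
triple (a , b , c) = Vec.tabulate λ i → (toℕ i ≡ᵇ a) ∨ (toℕ i ≡ᵇ b) ∨ (toℕ i ≡ᵇ c)

-- The points 0, …, 13 are the residues modulo 14, the point 14 is the apex of the
-- star, and 15, …, 25 are the vertices of its graph.
baseBlocks : List (ℕ × ℕ × ℕ)
baseBlocks = (0 , 1 , 2) ∷ (0 , 1 , 3) ∷ (0 , 1 , 4) ∷ (0 , 1 , 7) ∷ (0 , 2 , 4) ∷
             (0 , 2 , 8) ∷ (0 , 3 , 6) ∷ (0 , 3 , 7) ∷ (0 , 4 , 8) ∷ []

cyclicPart : List (ℕ × ℕ × ℕ)
cyclicPart = concatMap (λ i → map (λ (a , b , c) → (i + a) % 14 , (i + b) % 14 , (i + c) % 14) baseBlocks) (upTo 14)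

-- On 11 cyclic vertices, the differences 1 and 2 give 22 edges and degree 4. Five disjoint edges of
-- difference 5 raise ten of the degrees to 5.
starPart : List (ℕ × ℕ × ℕ)
starPart = concatMap (λ i → edge i (i + 1) ∷ edge i (i + 2) ∷ []) (upTo 11) ++ map (λ i → edge i (i + 5)) (upTo 5)
  where
  edge : ℕ → ℕ → ℕ × ℕ × ℕ
  edge i j = 14 , 15 + i % 11 , 15 + j % 11

family : List (Subset 26)
family = map triple (cyclicPart ++ starPart)

-- Excluding each core by counting tokens

containing : Subset 26 → List (Subset 26)
containing C = filter (C ⊆?_) family

Petal : Subset 26 → Fin 26 → Subset 26 → Set
Petal C v A = v ∈ˢ A × v ∉ˢ C

petal? : ∀ C v A → Dec (Petal C v A)
petal? C v A = v ∈ˢ? A ×-dec ¬? (v ∈ˢ? C)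

-- Points with multiplicities.  For the empty core the apex counts three times and
-- its 11 neighbours do not count, so that every member of the family has weight 3.
tokens : Subset 26 → List (Subset 26) → List (Fin 26)
tokens C D with nonempty? C
... | yes _ = filter (λ v → any? (petal? C v) D) (allFin 26)
... | no  _ = filter (λ v → toℕ v <? 14) (allFin 26) ++ replicate 3 (# 14)

-- Six sets of D with pairwise intersection C would have disjoint petals, each with
-- s of the fewer than 6 * s tokens in T.
Scarce : Subset 26 → ℕ → List (Subset 26) → List (Fin 26) → Set
Scarce C s D T = length T < 6 * s × All (λ A → s ≤ count (λ v → petal? C v A) T) D

scarce? : ∀ C s D T → Dec (Scarce C s D T)
scarce? C s D T = length T <? 6 * s ×-dec All.all? (λ A → s ≤? count (λ v → petal? C v A) T) D

-- The empty core has 14 + 3 = 17 < 18 tokens, a one-point core at most 11 < 12, and a two-point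
-- core at most 5 < 6.
NoCore : Subset 26 → List (Subset 26) → Set
NoCore C D = Scarce C (3 ∸ ∣ C ∣) D (tokens C D)

noCore? : ∀ C D → Dec (NoCore C D)
noCore? C D = scarce? C (3 ∸ ∣ C ∣) D (tokens C D)

family-distinct : Unique family
family-distinct = from-yes (UniqueDec.unique? _≟ˢ_ family)

family-uniform : All (λ A → ∣ A ∣ ≡ 3) family
family-uniform = from-yes (All.all? (λ A → ∣ A ∣ Data.Nat.≟ 3) family)

-- Evaluated over the candidate cores, which avoids a search through sextuples of triples.
all-noCore : All (λ C → NoCore C (containing C)) (subsets≤ 2 26)
all-noCore = from-yes (All.all? (λ C → noCore? C (containing C)) (subsets≤ 2 26))

family-sunflowerFree : SunflowerFree 3 6 family
family-sunflowerFree = record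
  { distinct = family-distinct ; uniform = family-uniform ; noSunflower = noSunflower }
  where
  noSunflower : ¬ ContainsSunflower 6 family
  noSunflower (A , (A-inj , C , AC) , A∈F) = <⇒≱ T<6s 6s≤T
    where
    open ≤-Reasoning
    partner : ∀ i → ∃[ j ] i ≢ j
    partner zero    = suc zero , λ ()
    partner (suc i) = zero , λ ()
    C⊆A : ∀ i → C ⊆ A i
    C⊆A i {x} x∈C = let j , i≢j = partner i in
      p∩q⊆p (A i) (A j) (subst (x ∈ˢ_) (sym (AC i j i≢j)) x∈C)
    -- A core with three points would equal every set of the sunflower, but these are distinct.
    C≤2 : ∣ C ∣ ≤ 2
    C≤2 = ≮⇒≥ λ 3≤C → contradiction (A-inj {zero} {suc zero} (trans (sym (C≡A 3≤C zero)) (C≡A 3≤C (suc zero)))) λ ()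
      where
      C≡A : 3 ≤ ∣ C ∣ → ∀ i → C ≡ A i
      C≡A 3≤C i = ⊆∧∣∣≤⇒≡ (C⊆A i) (subst (_≤ ∣ C ∣) (sym (All.lookup family-uniform (A∈F i))) 3≤C)
    T : List (Fin 26)
    T = tokens C (containing C)
    s : ℕ
    s = 3 ∸ ∣ C ∣
    scarce : NoCore C (containing C)
    scarce = All.lookup all-noCore (∈-subsets≤ C C≤2)
    T<6s : length T < 6 * s
    T<6s = proj₁ scarce
    L : List (Subset 26)
    L = tabulate A
    petals-disjoint : ∀ v → count (petal? C v) L ≤ 1
    petals-disjoint v = all-equal⇒length≤1 (Uniqueₚ.filter⁺ (petal? C v) (Uniqueₚ.tabulate⁺ A-inj)) same
      where
      same : ∀ {B B′} → B ∈ filter (petal? C v) L → B′ ∈ filter (petal? C v) L → B ≡ B′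
      same B∈ B′∈ with ∈-filter⁻ (petal? C v) {xs = L} B∈ | ∈-filter⁻ (petal? C v) {xs = L} B′∈
      ... | B∈L , v∈B , v∉C | B′∈L , v∈B′ , _ with ∈-tabulate⁻ {f = A} B∈L | ∈-tabulate⁻ {f = A} B′∈L
      ... | i , refl | j , refl with i ≟ᶠ j
      ... | yes i≡j = cong A i≡j
      ... | no  i≢j = contradiction (subst (v ∈ˢ_) (AC i j i≢j) (x∈p∩q⁺ (v∈B , v∈B′))) v∉C
    many-tokens : ∀ {B} → B ∈ L → s ≤ count (λ v → petal? C v B) T
    many-tokens B∈L with ∈-tabulate⁻ {f = A} B∈L
    ... | i , refl = All.lookup (proj₂ scarce) (∈-filter⁺ (C ⊆?_) (A∈F i) (C⊆A i))
    6s≤T : 6 * s ≤ length T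
    6s≤T = begin
      6 * s                                          ≡⟨ ∑-const L s ⟨
      ∑ L (λ _ → s)                                  ≤⟨ ∑-mono L many-tokens ⟩
      ∑ L (λ B → count (λ v → petal? C v B) T)       ≡⟨ double-count (λ B v → petal? C v B) L T ⟩
      ∑ T (λ v → count (petal? C v) L)               ≤⟨ ∑-mono T (λ {v} _ → petals-disjoint v) ⟩
      ∑ T (λ _ → 1)                                  ≡⟨ ∑-const T 1 ⟩
      length T * 1                                   ≡⟨ *-identityʳ _ ⟩
      length T                                       ∎

attained-153 : Attained 3 6 153
attained-153 = 26 , family , family-sunflowerFree , refl

attained⇒≤255 : ∀ m → Attained 3 6 m → m ≤ 255
attained⇒≤255 m (n , F , S , refl) = sunflowerFree⇒≤255 F S

greatest⇒isMaxSize : ∀ {w k m} → Attained w k m → (∀ m′ → Attained w k m′ → m′ ≤ m) → IsMaxSize w k m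
greatest⇒isMaxSize attained m-greatest = record
  { attained   = attained
  ; upperBound = λ F S → m-greatest _ (_ , F , S , refl)
  }

theorem7p3 : ∃[ m ] (IsMaxSize 3 6 m × 153 ≤ m × m ≤ 255)
theorem7p3 =
  -- The argument 4 stands for sunflowers with 2 + 4 sets.
  let m , attained , m-greatest = greatest (attained? 3 4) 255 attained⇒≤255 attained-153
  in m , greatest⇒isMaxSize attained m-greatest , m-greatest 153 attained-153 , attained⇒≤255 m attained
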